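{- There is no Eisenstein lattice equable parallelogram having a vertical diagonal.
   Context: A planar polygon is equable if its perimeter equals its area. The Eisenstein lattice is $\mathbb{Z}[\omega]\subset\mathbb{C}$, where $\omega=-\frac12+i\frac{\sqrt3}{2}$. An Eisenstein lattice equable parallelogram (ELEP) is an equable parallelogram whose vertices all lie in $\mathbb{Z}[\omega]$. Vertical means parallel to the imaginary axis. -}

module Defs where

open import Data.Nat.Base as ℕ using (ℕ; zero; suc)
import Data.Nat.Properties as ℕₚ
import Data.Nat.DivMod as ℕ
open import Data.Integer.Base as ℤ using (ℤ)
import Data.Integer.Properties as ℤₚ
open import Data.Rational.Base hiding (_≃_)
open import Data.Rational.Properties
open import Data.Rational.Solver using (module +-*-Solver)
import Data.Rational.Unnormalised.Base as ℚᵘ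
import Data.Rational.Unnormalised.Properties as ℚᵘₚ
open import Data.List.Base using (List; []; _∷_; _∷ʳ_; zip; map; foldr)
open import Data.List.Relation.Unary.All using (All)
open import Data.Product.Base using (∃; ∃₂; _×_; _,_)
open import Data.Sum.Base using (_⊎_; inj₁; inj₂)
open import Relation.Nullary.Decidable using (yes; no)
open import Relation.Nullary.Negation using (¬_; contradiction)
open import Relation.Binary.PropositionalEquality
  using (_≡_; refl; sym; trans; cong; subst; subst₂; module ≡-Reasoning)

open +-*-Solver using (solve; _:+_; _:*_; :-_; _:-_; _:=_; con)

abstract
  0<½ : 0ℚ < ½
  0<½ = positive⁻¹ ½

  <⇒≱ : ∀ {p q} → p < q → ¬ (q ≤ p)
  <⇒≱ p<q q≤p = <-irrefl refl (<-≤-trans p<q q≤p)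

  *-pos : ∀ {p q} → 0ℚ < p → 0ℚ < q → 0ℚ < p * q
  *-pos {p} {q} 0<p 0<q =
    subst (_< p * q) (*-zeroʳ p) (*-monoʳ-<-pos p {{positive 0<p}} 0<q)

  halves : ∀ p → ½ * p + ½ * p ≡ p
  halves = solve 1 (λ p → con ½ :* p :+ con ½ :* p := p) refl

  half< : ∀ {p} → 0ℚ < p → ½ * p < p
  half< {p} 0<p = subst₂ _<_ (+-identityʳ (½ * p)) (halves p)
    (+-monoʳ-< (½ * p) (*-pos 0<½ 0<p))

  +-halves< : ∀ {p q ε} → p < ½ * ε → q < ½ * ε → p + q < ε
  +-halves< {p} {q} {ε} p< q< = subst (p + q <_) (halves ε) (+-mono-< p< q<)

  ∣p-q∣≡∣q-p∣ : ∀ p q → ∣ p - q ∣ ≡ ∣ q - p ∣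
  ∣p-q∣≡∣q-p∣ p q = trans (sym (∣-p∣≡∣p∣ (p - q)))
    (cong ∣_∣ (solve 2 (λ p q → :- (p :- q) := q :- p) refl p q))

  p≤∣p∣ : ∀ p → p ≤ ∣ p ∣
  p≤∣p∣ p with ≤-total 0ℚ p
  ... | inj₁ 0≤p = ≤-reflexive (sym (0≤p⇒∣p∣≡p 0≤p))
  ... | inj₂ p≤0 = ≤-trans p≤0 (0≤∣p∣ p)

  p<q+r⇒p-q<r : ∀ {p q r} → p < q + r → p - q < r
  p<q+r⇒p-q<r {p} {q} {r} p<q+r = subst (p - q <_)
    (solve 2 (λ q r → (q :+ r) :- q := r) refl q r) (+-monoˡ-< (- q) p<q+r)

  p-q<r⇒p<q+r : ∀ {p q r} → p - q < r → p < q + r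
  p-q<r⇒p<q+r {p} {q} {r} p-q<r = subst (_< q + r)
    (solve 2 (λ p q → q :+ (p :- q) := p) refl p q) (+-monoʳ-< q p-q<r)

  ∣-∣<⇒<+ : ∀ {p q ε} → ∣ p - q ∣ < ε → p < q + ε
  ∣-∣<⇒<+ {p} {q} d = p-q<r⇒p<q+r (≤-<-trans (p≤∣p∣ (p - q)) d)

  <+⇒∣-∣< : ∀ {p q ε} → p < q + ε → q < p + ε → ∣ p - q ∣ < ε
  <+⇒∣-∣< {p} {q} {ε} p< q< with ∣p∣≡p∨∣p∣≡-p (p - q)
  ... | inj₁ eq = subst (_< ε) (sym eq) (p<q+r⇒p-q<r p<)
  ... | inj₂ eq = subst (_< ε)
    (trans (solve 2 (λ p q → q :- p := :- (p :- q)) refl p q) (sym eq))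
    (p<q+r⇒p-q<r q<)

  <+-monoˡ : ∀ {p q r ε} → q ≤ r → p < q + ε → p < r + ε
  <+-monoˡ {ε = ε} q≤r p< = <-≤-trans p< (+-monoˡ-≤ ε q≤r)

  ∣p∣≤∣q∣+∣p-q∣ : ∀ p q → ∣ p ∣ ≤ ∣ q ∣ + ∣ p - q ∣
  ∣p∣≤∣q∣+∣p-q∣ p q = subst (λ t → ∣ t ∣ ≤ ∣ q ∣ + ∣ p - q ∣)
    (solve 2 (λ p q → q :+ (p :- q) := p) refl p q) (∣p+q∣≤∣p∣+∣q∣ q (p - q))

  ∣p∣<∣q∣+ε : ∀ {p q ε} → ∣ p - q ∣ < ε → ∣ p ∣ < ∣ q ∣ + ε
  ∣p∣<∣q∣+ε {p} {q} d = ≤-<-trans (∣p∣≤∣q∣+∣p-q∣ p q) (+-monoʳ-< ∣ q ∣ d)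

  ∣-∣-sym : ∀ {p q ε} → ∣ p - q ∣ < ε → ∣ q - p ∣ < ε
  ∣-∣-sym {p} {q} {ε} = subst (_< ε) (∣p-q∣≡∣q-p∣ p q)

  ∣-∣-nonexpansive : ∀ {p q ε} → ∣ p - q ∣ < ε → ∣ ∣ p ∣ - ∣ q ∣ ∣ < ε
  ∣-∣-nonexpansive {p} {q} d =
    <+⇒∣-∣< (∣p∣<∣q∣+ε {p} {q} d) (∣p∣<∣q∣+ε {q} {p} (∣-∣-sym {p} {q} d))

  ⊔0-nonexpansive : ∀ {p q ε} → 0ℚ < ε → ∣ p - q ∣ < ε → ∣ (p ⊔ 0ℚ) - (q ⊔ 0ℚ) ∣ < ε
  ⊔0-nonexpansive {p} {q} {ε} 0<ε d = <+⇒∣-∣< (bound p q d) (bound q p (∣-∣-sym {p} {q} d))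
    where
    bound : ∀ p q → ∣ p - q ∣ < ε → p ⊔ 0ℚ < (q ⊔ 0ℚ) + ε
    bound p q d with ⊔-sel p 0ℚ
    ... | inj₁ eq = subst (_< (q ⊔ 0ℚ) + ε) (sym eq) (<+-monoˡ (p≤p⊔q q 0ℚ) (∣-∣<⇒<+ d))
    ... | inj₂ eq = subst (_< (q ⊔ 0ℚ) + ε) (sym eq)
      (<+-monoˡ (p≤q⊔p q 0ℚ) (subst (0ℚ <_) (sym (+-identityˡ ε)) 0<ε))

IsCauchy : (ℕ → ℚ) → Set
IsCauchy s = ∀ ε → 0ℚ < ε → ∃ λ N → ∀ m n → N ℕ.≤ m → N ℕ.≤ n → ∣ s m - s n ∣ < ε

-- Two sequences represent the same real when _≃_ relates them.
record ℝ : Set where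
  constructor mkℝ
  field
    seq    : ℕ → ℚ
    cauchy : IsCauchy seq

open ℝ public

infix  4 _≃_
infixl 6 _+ʳ_ _-ʳ_
infixl 7 _*ʳ_
infix  8 -ʳ_

_≃_ : ℝ → ℝ → Set
x ≃ y = ∀ ε → 0ℚ < ε → ∃ λ N → ∀ n → N ℕ.≤ n → ∣ seq x n - seq y n ∣ < ε

abstract
  const-cauchy : ∀ q → IsCauchy (λ _ → q)
  const-cauchy q ε 0<ε =
    0 , λ _ _ _ _ → subst (_< ε) (sym (cong ∣_∣ (+-inverseʳ q))) 0<ε

  +-cauchy : ∀ {s t} → IsCauchy s → IsCauchy t → IsCauchy (λ n → s n + t n)
  +-cauchy {s} {t} cs ct ε 0<ε =
    let M , hs = cs (½ * ε) (*-pos {½} {ε} 0<½ 0<ε)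
        N , ht = ct (½ * ε) (*-pos {½} {ε} 0<½ 0<ε)
    in M ℕ.⊔ N , λ m n m≥ n≥ → ≤-<-trans
    (subst (_≤ ∣ s m - s n ∣ + ∣ t m - t n ∣)
      (cong ∣_∣ (solve 4 (λ a b c d → (a :- c) :+ (b :- d) := (a :+ b) :- (c :+ d)) refl
        (s m) (t m) (s n) (t n)))
      (∣p+q∣≤∣p∣+∣q∣ (s m - s n) (t m - t n)))
    (+-halves< (hs m n (ℕₚ.m⊔n≤o⇒m≤o M N m≥) (ℕₚ.m⊔n≤o⇒m≤o M N n≥))
               (ht m n (ℕₚ.m⊔n≤o⇒n≤o M N m≥) (ℕₚ.m⊔n≤o⇒n≤o M N n≥)))

  neg-cauchy : ∀ {s} → IsCauchy s → IsCauchy (λ n → - s n)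
  neg-cauchy {s} cs ε 0<ε with cs ε 0<ε
  ... | N , hs = N , λ m n m≥ n≥ → subst (_< ε)
    (cong ∣_∣ (solve 2 (λ a b → b :- a := :- a :- :- b) refl (s m) (s n)))
    (hs n m n≥ m≥)

  abs-cauchy : ∀ {s} → IsCauchy s → IsCauchy (λ n → ∣ s n ∣)
  abs-cauchy {s} cs ε 0<ε =
    let N , hs = cs ε 0<ε
    in N , λ m n m≥ n≥ → ∣-∣-nonexpansive {s m} {s n} (hs m n m≥ n≥)

  cauchy-bounded : ∀ {s} → IsCauchy s →
    ∃ λ B → 0ℚ < B × ∃ λ N → ∀ n → N ℕ.≤ n → ∣ s n ∣ ≤ B
  cauchy-bounded {s} cs with cs 1ℚ (positive⁻¹ 1ℚ)
  ... | N , hs = ∣ s N ∣ + 1ℚ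
    , +-mono-≤-< (0≤∣p∣ (s N)) (positive⁻¹ 1ℚ)
    , N , λ n n≥ → <⇒≤ (∣p∣<∣q∣+ε {s n} {s N} (hs n N n≥ ℕₚ.≤-refl))

  divide : ∀ {B ε} → 0ℚ < B → 0ℚ < ε → ∃ λ η → 0ℚ < η × B * η ≡ ε
  divide {B} {ε} 0<B 0<ε = 1/B * ε , *-pos (positive⁻¹ 1/B {{1/pos⇒pos B}}) 0<ε , (begin
    B * (1/B * ε)   ≡⟨ *-assoc B 1/B ε ⟨
    B * 1/B * ε     ≡⟨ cong (_* ε) (*-inverseʳ B) ⟩
    1ℚ * ε          ≡⟨ *-identityˡ ε ⟩
    ε               ∎)
    where
    open ≡-Reasoning
    instance
      posB : Positive B
      posB = positive 0<B
      nzB : NonZero B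
      nzB = pos⇒nonZero B
    1/B : ℚ
    1/B = 1/ B

  ∣*∣-bound : ∀ {p q B η} → ∣ p ∣ ≤ B → ∣ q ∣ < η → ∣ p * q ∣ ≤ B * η
  ∣*∣-bound {p} {q} {B} {η} p≤ q< = begin
    ∣ p * q ∣       ≡⟨ ∣p*q∣≡∣p∣*∣q∣ p q ⟩
    ∣ p ∣ * ∣ q ∣   ≤⟨ *-monoˡ-≤-nonNeg ∣ p ∣ {{∣-∣-nonNeg p}} (<⇒≤ q<) ⟩
    ∣ p ∣ * η       ≤⟨ *-monoʳ-≤-nonNeg η {{nonNegative 0≤η}} p≤ ⟩
    B * η           ∎
    where
    open ≤-Reasoning
    0≤η : 0ℚ ≤ η
    0≤η = ≤-trans (0≤∣p∣ q) (<⇒≤ q<)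

  product-difference : ∀ a b c d → a * b - c * d ≡ a * (b - d) + d * (a - c)
  product-difference = solve 4
    (λ a b c d → a :* b :- c :* d := a :* (b :- d) :+ d :* (a :- c)) refl

  ∣ab-cd∣-bound : ∀ {a b c d B B′ η} → ∣ a ∣ ≤ B → ∣ d ∣ ≤ B′ →
    ∣ b - d ∣ < η → ∣ a - c ∣ < η → ∣ a * b - c * d ∣ ≤ (B + B′) * η
  ∣ab-cd∣-bound {a} {b} {c} {d} {B} {B′} {η} a≤ d≤ b-d< a-c< = begin
    ∣ a * b - c * d ∣
      ≡⟨ cong ∣_∣ (product-difference a b c d) ⟩
    ∣ a * (b - d) + d * (a - c) ∣
      ≤⟨ ∣p+q∣≤∣p∣+∣q∣ (a * (b - d)) (d * (a - c)) ⟩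
    ∣ a * (b - d) ∣ + ∣ d * (a - c) ∣
      ≤⟨ +-mono-≤ (∣*∣-bound {a} {b - d} a≤ b-d<) (∣*∣-bound {d} {a - c} d≤ a-c<) ⟩
    B * η + B′ * η
      ≡⟨ *-distribʳ-+ η B B′ ⟨
    (B + B′) * η ∎
    where open ≤-Reasoning

  *-cauchy : ∀ {s t} → IsCauchy s → IsCauchy t → IsCauchy (λ n → s n * t n)
  *-cauchy {s} {t} cs ct ε 0<ε =
    let Bs , 0<Bs , Ms , bs = cauchy-bounded {s} cs
        Bt , 0<Bt , Mt , bt = cauchy-bounded {t} ct
        η , 0<η , Bη≡½ε = divide {Bs + Bt} {½ * ε} (+-mono-< 0<Bs 0<Bt) (*-pos 0<½ 0<ε)
        Ns , hs = cs η 0<η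
        Nt , ht = ct η 0<η
        M = Ms ℕ.⊔ Mt
        N = Ns ℕ.⊔ Nt
    in M ℕ.⊔ N , λ m n m≥ n≥ →
      let m≥M = ℕₚ.m⊔n≤o⇒m≤o M N m≥
          n≥M = ℕₚ.m⊔n≤o⇒m≤o M N n≥
          m≥N = ℕₚ.m⊔n≤o⇒n≤o M N m≥
          n≥N = ℕₚ.m⊔n≤o⇒n≤o M N n≥
      in ≤-<-trans
        (∣ab-cd∣-bound {s m} {t m} {s n} {t n}
          (bs m (ℕₚ.m⊔n≤o⇒m≤o Ms Mt m≥M)) (bt n (ℕₚ.m⊔n≤o⇒n≤o Ms Mt n≥M))
          (ht m n (ℕₚ.m⊔n≤o⇒n≤o Ns Nt m≥N) (ℕₚ.m⊔n≤o⇒n≤o Ns Nt n≥N))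
          (hs m n (ℕₚ.m⊔n≤o⇒m≤o Ns Nt m≥N) (ℕₚ.m⊔n≤o⇒m≤o Ns Nt n≥N)))
        (subst (_< ε) (sym Bη≡½ε) (half< 0<ε))

fromℚ : ℚ → ℝ
fromℚ q = mkℝ (λ _ → q) (const-cauchy q)

fromℤ : ℤ → ℝ
fromℤ a = fromℚ (a / 1)

0ʳ : ℝ
0ʳ = fromℚ 0ℚ

_+ʳ_ : ℝ → ℝ → ℝ
x +ʳ y = mkℝ (λ n → seq x n + seq y n) (+-cauchy {seq x} {seq y} (cauchy x) (cauchy y))

-ʳ_ : ℝ → ℝ
-ʳ x = mkℝ (λ n → - seq x n) (neg-cauchy {seq x} (cauchy x))

_-ʳ_ : ℝ → ℝ → ℝ
x -ʳ y = x +ʳ -ʳ y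

_*ʳ_ : ℝ → ℝ → ℝ
x *ʳ y = mkℝ (λ n → seq x n * seq y n) (*-cauchy {seq x} {seq y} (cauchy x) (cauchy y))

∣_∣ʳ : ℝ → ℝ
∣ x ∣ʳ = mkℝ (λ n → ∣ seq x n ∣) (abs-cauchy {seq x} (cauchy x))

√-step : ℕ → ℕ → ℕ
√-step m k with suc k ℕ.* suc k ℕₚ.≤? m
... | yes _ = suc k
... | no  _ = k

-- The largest k with k * k ≤ m.
⌊√_⌋ : ℕ → ℕ
⌊√ zero ⌋  = 0
⌊√ suc m ⌋ = √-step (suc m) ⌊√ m ⌋

abstract
  √-step-lower : ∀ m k → k ℕ.* k ℕ.≤ m → √-step (suc m) k ℕ.* √-step (suc m) k ℕ.≤ suc m
  √-step-lower m k k²≤m with suc k ℕ.* suc k ℕₚ.≤? suc m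
  ... | yes le = le
  ... | no  _  = ℕₚ.m≤n⇒m≤1+n k²≤m

  √-step-upper : ∀ m k → m ℕ.< suc k ℕ.* suc k →
    suc m ℕ.< suc (√-step (suc m) k) ℕ.* suc (√-step (suc m) k)
  √-step-upper m k m<k² with suc k ℕ.* suc k ℕₚ.≤? suc m
  ... | yes _  = ℕₚ.≤-<-trans m<k² (ℕₚ.*-mono-< (ℕₚ.n<1+n (suc k)) (ℕₚ.n<1+n (suc k)))
  ... | no  nl = ℕₚ.≰⇒> nl

  ⌊√⌋-lower : ∀ m → ⌊√ m ⌋ ℕ.* ⌊√ m ⌋ ℕ.≤ m
  ⌊√⌋-lower zero    = ℕ.z≤n
  ⌊√⌋-lower (suc m) = √-step-lower m ⌊√ m ⌋ (⌊√⌋-lower m)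

  ⌊√⌋-upper : ∀ m → m ℕ.< suc ⌊√ m ⌋ ℕ.* suc ⌊√ m ⌋
  ⌊√⌋-upper zero    = ℕ.s≤s ℕ.z≤n
  ⌊√⌋-upper (suc m) = √-step-upper m ⌊√ m ⌋ (⌊√⌋-upper m)

-- For q ≥ 0, the largest multiple of 1/(n+1) whose square is at most q.
√≈ : ℕ → ℚ → ℚ
√≈ n q = ℤ.+ ⌊√ (ℤ.∣ ↥ q ∣ ℕ.* (suc n ℕ.* suc n)) ℕ./ ↧ₙ q ⌋ / suc n

mesh : ℕ → ℚ
mesh n = ℤ.+ 1 / suc n

abstract
  mesh>0 : ∀ n → 0ℚ < mesh n
  mesh>0 n = positive⁻¹ (mesh n) {{normalize-pos 1 (suc n)}}

  √≈-nonNeg : ∀ n q → 0ℚ ≤ √≈ n q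
  √≈-nonNeg n q = nonNegative⁻¹ (√≈ n q) {{normalize-nonNeg k (suc n)}}
    where
    k : ℕ
    k = ⌊√ (ℤ.∣ ↥ q ∣ ℕ.* (suc n ℕ.* suc n)) ℕ./ ↧ₙ q ⌋

  /-square : ∀ k n → toℚᵘ (ℤ.+ k / suc n * (ℤ.+ k / suc n))
    ℚᵘ.≃ ℚᵘ.mkℚᵘ (ℤ.+ k) n ℚᵘ.* ℚᵘ.mkℚᵘ (ℤ.+ k) n
  /-square k n = ℚᵘₚ.≃-trans (toℚᵘ-homo-* (ℤ.+ k / suc n) (ℤ.+ k / suc n))
    (ℚᵘₚ.*-cong (toℚᵘ-fromℚᵘ (ℚᵘ.mkℚᵘ (ℤ.+ k) n)) (toℚᵘ-fromℚᵘ (ℚᵘ.mkℚᵘ (ℤ.+ k) n)))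

  clear-denominators : ∀ k s →
    ℤ.+ suc k ℤ.* (s ℤ.* s) ≡ (ℤ.+ k ℤ.* s ℤ.+ ℤ.+ 1 ℤ.* s) ℤ.* s
  clear-denominators k s = begin
    ℤ.+ suc k ℤ.* (s ℤ.* s)               ≡⟨ ℤₚ.*-assoc (ℤ.+ suc k) s s ⟨
    ℤ.+ suc k ℤ.* s ℤ.* s                 ≡⟨ cong (λ t → t ℤ.* s ℤ.* s) (ℤₚ.+-comm (ℤ.+ 1) (ℤ.+ k)) ⟩
    (ℤ.+ k ℤ.+ ℤ.+ 1) ℤ.* s ℤ.* s         ≡⟨ cong (ℤ._* s) (ℤₚ.*-distribʳ-+ s (ℤ.+ k) (ℤ.+ 1)) ⟩
    (ℤ.+ k ℤ.* s ℤ.+ ℤ.+ 1 ℤ.* s) ℤ.* s   ∎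
    where open ≡-Reasoning

  +-step : ∀ k n → ℤ.+ suc k / suc n ≡ ℤ.+ k / suc n + mesh n
  +-step k n = toℚᵘ-injective (begin
    toℚᵘ (ℤ.+ suc k / suc n)
      ≈⟨ toℚᵘ-fromℚᵘ (ℚᵘ.mkℚᵘ (ℤ.+ suc k) n) ⟩
    ℚᵘ.mkℚᵘ (ℤ.+ suc k) n
      ≈⟨ ℚᵘ.*≡* (clear-denominators k (ℤ.+ suc n)) ⟩
    ℚᵘ.mkℚᵘ (ℤ.+ k) n ℚᵘ.+ ℚᵘ.mkℚᵘ (ℤ.+ 1) n
      ≈⟨ ℚᵘₚ.+-cong (toℚᵘ-fromℚᵘ (ℚᵘ.mkℚᵘ (ℤ.+ k) n)) (toℚᵘ-fromℚᵘ (ℚᵘ.mkℚᵘ (ℤ.+ 1) n)) ⟨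
    toℚᵘ (ℤ.+ k / suc n) ℚᵘ.+ toℚᵘ (mesh n)
      ≈⟨ toℚᵘ-homo-+ (ℤ.+ k / suc n) (mesh n) ⟨
    toℚᵘ (ℤ.+ k / suc n + mesh n) ∎)
    where
    open import Relation.Binary.Reasoning.Setoid ℚᵘₚ.≃-setoid

  √≈-lower : ∀ n q → 0ℚ ≤ q → √≈ n q * √≈ n q ≤ q
  √≈-lower n q@(mkℚ ℤ.-[1+ _ ] _ _) 0≤q = contradiction 0≤q (<⇒≱ (negative⁻¹ q))
  √≈-lower n q@(mkℚ (ℤ.+ a) d _) _ = toℚᵘ-cancel-≤
    (ℚᵘₚ.≤-respˡ-≃ (ℚᵘₚ.≃-sym (/-square k n)) (ℚᵘ.*≤* (subst₂ ℤ._≤_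
      (trans (ℤₚ.pos-* (k ℕ.* k) (suc d)) (cong (ℤ._* ℤ.+ suc d) (ℤₚ.pos-* k k)))
      (ℤₚ.pos-* a (suc n ℕ.* suc n))
      (ℤ.+≤+ k²d≤))))
    where
    M k : ℕ
    M = a ℕ.* (suc n ℕ.* suc n)
    k = ⌊√ M ℕ./ suc d ⌋
    k²d≤ : k ℕ.* k ℕ.* suc d ℕ.≤ M
    k²d≤ = ℕₚ.≤-trans (ℕₚ.*-monoˡ-≤ (suc d) (⌊√⌋-lower (M ℕ./ suc d))) (ℕ.m/n*n≤m M (suc d))

  √≈-upper : ∀ n q → 0ℚ ≤ q → q < (√≈ n q + mesh n) * (√≈ n q + mesh n)
  √≈-upper n q@(mkℚ ℤ.-[1+ _ ] _ _) 0≤q = contradiction 0≤q (<⇒≱ (negative⁻¹ q))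
  √≈-upper n q@(mkℚ (ℤ.+ a) d _) _ = subst (λ r → q < r * r) (+-step k n) (toℚᵘ-cancel-<
    (ℚᵘₚ.<-respʳ-≃ (ℚᵘₚ.≃-sym (/-square (suc k) n)) (ℚᵘ.*<* (subst₂ ℤ._<_
      (ℤₚ.pos-* a (suc n ℕ.* suc n))
      (trans (ℤₚ.pos-* (suc k ℕ.* suc k) (suc d)) (cong (ℤ._* ℤ.+ suc d) (ℤₚ.pos-* (suc k) (suc k))))
      (ℤ.+<+ <k²d)))))
    where
    M k : ℕ
    M = a ℕ.* (suc n ℕ.* suc n)
    k = ⌊√ M ℕ./ suc d ⌋
    <k²d : M ℕ.< suc k ℕ.* suc k ℕ.* suc d
    <k²d = begin-strict
      M
        ≡⟨ ℕ.m≡m%n+[m/n]*n M (suc d) ⟩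
      M ℕ.% suc d ℕ.+ M ℕ./ suc d ℕ.* suc d
        <⟨ ℕₚ.+-monoˡ-< (M ℕ./ suc d ℕ.* suc d) (ℕ.m%n<n M (suc d)) ⟩
      suc (M ℕ./ suc d) ℕ.* suc d
        ≤⟨ ℕₚ.*-monoˡ-≤ (suc d) (⌊√⌋-upper (M ℕ./ suc d)) ⟩
      suc k ℕ.* suc k ℕ.* suc d ∎
      where open ℕₚ.≤-Reasoning

  archimedean : ∀ ε → 0ℚ < ε → ∃ λ N → ∀ n → N ℕ.≤ n → mesh n ≤ ε
  archimedean ε@(mkℚ (ℤ.+ zero) _ _)  0<ε = contradiction (*≤* ℤₚ.≤-refl) (<⇒≱ 0<ε)
  archimedean ε@(mkℚ (ℤ.-[1+ _ ]) _ _) 0<ε = contradiction (<⇒≤ (negative⁻¹ ε)) (<⇒≱ 0<ε)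
  archimedean ε@(mkℚ (ℤ.+ suc a) d _) 0<ε = d , λ n d≤n → toℚᵘ-cancel-≤
    (ℚᵘₚ.≤-respˡ-≃ (ℚᵘₚ.≃-sym (toℚᵘ-fromℚᵘ (ℚᵘ.mkℚᵘ (ℤ.+ 1) n))) (ℚᵘ.*≤* (subst₂ ℤ._≤_
      (ℤₚ.pos-* 1 (suc d)) (ℤₚ.pos-* (suc a) (suc n))
      (ℤ.+≤+ (ℕₚ.*-mono-≤ (ℕ.s≤s (ℕ.z≤n {a})) (ℕ.s≤s d≤n))))))

  square-mono : ∀ {p q} → 0ℚ ≤ p → p ≤ q → p * p ≤ q * q
  square-mono {p} {q} 0≤p p≤q = ≤-trans
    (*-monoˡ-≤-nonNeg p {{nonNegative 0≤p}} p≤q)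
    (*-monoʳ-≤-nonNeg q {{nonNegative (≤-trans 0≤p p≤q)}} p≤q)

  sum-of-squares : ∀ {p q} → 0ℚ ≤ p → 0ℚ ≤ q → p * p + q * q ≤ (p + q) * (p + q)
  sum-of-squares {p} {q} 0≤p 0≤q = begin
    p * p + q * q                       ≡⟨ +-identityʳ (p * p + q * q) ⟨
    p * p + q * q + 0ℚ                  ≤⟨ +-monoʳ-≤ (p * p + q * q) (+-mono-≤ 0≤pq 0≤pq) ⟩
    p * p + q * q + (p * q + p * q)     ≡⟨ solve 2 (λ p q →
      p :* p :+ q :* q :+ (p :* q :+ p :* q) := (p :+ q) :* (p :+ q)) refl p q ⟩
    (p + q) * (p + q)                   ∎
    where
    open ≤-Reasoning
    0≤pq : 0ℚ ≤ p * q
    0≤pq = nonNegative⁻¹ (p * q)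
      {{nonNeg*nonNeg⇒nonNeg p {{nonNegative 0≤p}} q {{nonNegative 0≤q}}}}

  -- If r ≤ √q ≤ r + δ and r′ ≤ √q′, then q′ < q + η² forces r′ < r + δ + η.
  √-modulus : ∀ {q q′ r r′ δ η} → 0ℚ ≤ r → 0ℚ < δ → 0ℚ < η →
    q < (r + δ) * (r + δ) → r′ * r′ ≤ q′ → q′ < q + η * η → r′ < r + δ + η
  √-modulus {q} {q′} {r} {r′} {δ} {η} 0≤r 0<δ 0<η q< r′≤ q′< = ≰⇒> λ r+δ+η≤r′ →
    <-irrefl refl (begin-strict
      (r + δ + η) * (r + δ + η)         ≤⟨ square-mono (+-mono-≤ 0≤r+δ (<⇒≤ 0<η)) r+δ+η≤r′ ⟩
      r′ * r′                           ≤⟨ r′≤ ⟩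
      q′                                <⟨ q′< ⟩
      q + η * η                         <⟨ +-monoˡ-< (η * η) q< ⟩
      (r + δ) * (r + δ) + η * η         ≤⟨ sum-of-squares 0≤r+δ (<⇒≤ 0<η) ⟩
      (r + δ + η) * (r + δ + η)         ∎)
    where
    open ≤-Reasoning
    0≤r+δ : 0ℚ ≤ r + δ
    0≤r+δ = +-mono-≤ 0≤r (<⇒≤ 0<δ)

  √≈-modulus : ∀ {m n q q′ ε} → 0ℚ ≤ q → 0ℚ ≤ q′ → 0ℚ < ε → mesh m ≤ ½ * ε →
    q′ < q + ½ * ε * (½ * ε) → √≈ n q′ < √≈ m q + ε
  √≈-modulus {m} {n} {q} {q′} {ε} 0≤q 0≤q′ 0<ε mesh≤ q′< = begin-strict
    √≈ n q′
      <⟨ √-modulus (√≈-nonNeg m q) (mesh>0 m) (*-pos 0<½ 0<ε)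
           (√≈-upper m q 0≤q) (√≈-lower n q′ 0≤q′) q′< ⟩
    √≈ m q + mesh m + ½ * ε
      ≤⟨ +-monoˡ-≤ (½ * ε) (+-monoʳ-≤ (√≈ m q) mesh≤) ⟩
    √≈ m q + ½ * ε + ½ * ε
      ≡⟨ +-assoc (√≈ m q) (½ * ε) (½ * ε) ⟩
    √≈ m q + (½ * ε + ½ * ε)
      ≡⟨ cong (√≈ m q +_) (halves ε) ⟩
    √≈ m q + ε ∎
    where open ≤-Reasoning

  √-cauchy : ∀ {s} → IsCauchy s → IsCauchy (λ n → √≈ n (s n ⊔ 0ℚ))
  √-cauchy {s} cs ε 0<ε =
    let 0<½ε = *-pos {½} {ε} 0<½ 0<ε
        0<½ε² = *-pos {½ * ε} {½ * ε} 0<½ε 0<½ε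
        M , hs = cs (½ * ε * (½ * ε)) 0<½ε²
        N , hN = archimedean (½ * ε) 0<½ε
        bound : ∀ m n → M ℕ.⊔ N ℕ.≤ m → M ℕ.⊔ N ℕ.≤ n →
          √≈ n (s n ⊔ 0ℚ) < √≈ m (s m ⊔ 0ℚ) + ε
        bound m n m≥ n≥ = √≈-modulus {m} {n} {s m ⊔ 0ℚ} {s n ⊔ 0ℚ} {ε}
          (p≤q⊔p (s m) 0ℚ) (p≤q⊔p (s n) 0ℚ) 0<ε (hN m (ℕₚ.m⊔n≤o⇒n≤o M N m≥))
          (∣-∣<⇒<+ {s n ⊔ 0ℚ} {s m ⊔ 0ℚ} (⊔0-nonexpansive {s n} {s m} 0<½ε²
            (hs n m (ℕₚ.m⊔n≤o⇒m≤o M N n≥) (ℕₚ.m⊔n≤o⇒m≤o M N m≥))))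
    in M ℕ.⊔ N , λ m n m≥ n≥ →
      <+⇒∣-∣< {√≈ m (s m ⊔ 0ℚ)} {√≈ n (s n ⊔ 0ℚ)} (bound n m n≥ m≥) (bound m n m≥ n≥)

-- √ x is the square root of max x 0, so it vanishes for negative x.
√ : ℝ → ℝ
√ x = mkℝ (λ n → √≈ n (seq x n ⊔ 0ℚ)) (√-cauchy {seq x} (cauchy x))

record ℂ : Set where
  constructor _+i_
  field
    re im : ℝ

open ℂ public

infix  4 _≃ᶜ_
infix  5 _+i_
infixl 6 _+ᶜ_ _-ᶜ_
infixl 7 _*ᶜ_

_≃ᶜ_ : ℂ → ℂ → Set
z ≃ᶜ w = re z ≃ re w × im z ≃ im w

_+ᶜ_ _-ᶜ_ _*ᶜ_ : ℂ → ℂ → ℂ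
(a +i b) +ᶜ (c +i d) = (a +ʳ c) +i (b +ʳ d)
(a +i b) -ᶜ (c +i d) = (a -ʳ c) +i (b -ʳ d)
(a +i b) *ᶜ (c +i d) = (a *ʳ c -ʳ b *ʳ d) +i (a *ʳ d +ʳ b *ʳ c)

ℤ⇒ℂ : ℤ → ℂ
ℤ⇒ℂ a = fromℤ a +i 0ʳ

∣_∣ᶜ : ℂ → ℝ
∣ z ∣ᶜ = √ (re z *ʳ re z +ʳ im z *ʳ im z)

ω : ℂ
ω = fromℚ (- ½) +i (fromℚ ½ *ʳ √ (fromℤ (ℤ.+ 3)))

_∈ℤ[ω] : ℂ → Set
z ∈ℤ[ω] = ∃₂ λ a b → z ≃ᶜ ℤ⇒ℂ a +ᶜ ℤ⇒ℂ b *ᶜ ω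

-- The vertices in cyclic order.
Polygon : Set
Polygon = List ℂ

edges : Polygon → List (ℂ × ℂ)
edges []       = []
edges (p ∷ ps) = zip (p ∷ ps) (ps ∷ʳ p)

sumʳ : List ℝ → ℝ
sumʳ = foldr _+ʳ_ 0ʳ

perimeter : Polygon → ℝ
perimeter P = sumʳ (map (λ (p , q) → ∣ q -ᶜ p ∣ᶜ) (edges P))

-- Twice the signed area of the triangle 0, p, q.
_∧_ : ℂ → ℂ → ℝ
p ∧ q = re p *ʳ im q -ʳ im p *ʳ re q

-- The shoelace formula; it gives the enclosed area when the polygon does not
-- cross itself.
area : Polygon → ℝ
area P = fromℚ ½ *ʳ ∣ sumʳ (map (λ (p , q) → p ∧ q) (edges P)) ∣ʳ

Equable : Polygon → Set
Equable P = perimeter P ≃ area P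

Collinear : ℂ → ℂ → ℂ → Set
Collinear p q r = (q -ᶜ p) ∧ (r -ᶜ p) ≃ 0ʳ

record Parallelogram : Set where
  field
    A B C D       : ℂ
    opposite      : B -ᶜ A ≃ᶜ C -ᶜ D
    nondegenerate : ¬ Collinear A B D

  vertices : Polygon
  vertices = A ∷ B ∷ C ∷ D ∷ []

IsELEP : Parallelogram → Set
IsELEP P = Equable vertices × All _∈ℤ[ω] vertices
  where open Parallelogram P

-- For distinct p and q, which the ends of a diagonal always are.
Vertical : ℂ → ℂ → Set
Vertical p q = re p ≃ re q

HasVerticalDiagonal : Parallelogram → Set
HasVerticalDiagonal P = Vertical A C ⊎ Vertical B D
  where open Parallelogram P

-- Let the sides be u = a + bω and v = c + dω, with norms N, N′, and put D = ad - bc.  Equability says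
-- 2(√N + √N′) = (√3/2)|D|.  Squaring twice gives (3D² - 16(N + N′))² = 1024 N N′ over ℤ.  If u + v is
-- vertical (for the other diagonal replace v by -v), then D = kx with k = a + c and x = 2a - b, and the
-- equation becomes 3(kx² + 16l)² = 64 N x² with l = b - k.  Hence x = 3y, and taking square roots leaves
-- (9y² - 16)(k² - m²) = 48y² for an integer m.  Only |y| = 4 makes the quotient an integer, and then
-- k² - m² = 6 is impossible modulo 4.
module Submission where

open import Defs
open import Data.Product.Base using (∃; _×_; _,_)
open import Relation.Nullary.Negation using (¬_; contradiction)
open import Data.Empty using (⊥)
open import Data.Integer.Base as ℤ using (ℤ)
import Data.Integer.Divisibility.Signed as ℤ∣
import Data.Integer.Properties as ℤₚ
import Data.Integer.Solver as ℤ-Solver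
open import Data.List.Base using ([]; _∷_)
open import Data.List.Relation.Unary.All using ([]; _∷_)
open import Data.Nat.Base as ℕ using (ℕ; suc; z≤n; s≤s)
open import Data.Nat.Coprimality using (Coprime; coprime-/gcd; coprime-divisor)
import Data.Nat.DivMod as ℕ
open import Data.Nat.Divisibility as ℕ using (_∣_; _∣?_; divides)
open import Data.Nat.GCD using (gcd; gcd[m,n]∣m; gcd[m,n]∣n; gcd[m,n]≢0)
open import Data.Nat.Primality using (Prime; prime?; euclidsLemma)
import Data.Nat.Properties as ℕₚ
import Data.Rational.Solver as ℚ-Solver
import Data.Rational.Unnormalised.Base as ℚᵘ
import Data.Rational.Unnormalised.Properties as ℚᵘₚ
open import Data.Sum.Base as ⊎ using (_⊎_; inj₁; inj₂; [_,_]′)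
open import Function.Base using (id)
open import Relation.Binary.Bundles using (Setoid)
open import Relation.Binary.PropositionalEquality
  using (_≡_; _≢_; refl; sym; trans; cong; cong₂; subst; subst₂; module ≡-Reasoning)
open import Relation.Nullary.Decidable using (yes; no; from-yes; from-no)

-- Integer equations

-- The real part of a + bω is a - b/2, so u + v is vertical exactly when b + d = 2k, that is u + v =
-- k(1 + 2ω) = k√3 i. Hence D, which is also the determinant of u and u + v, equals kx, where x is
-- twice the real part of u; and N′ = |(u + v) - u|² = N - 3kl. Once 3 divides x, it also divides N
-- and N′, and the reduced equation makes N/3 and N′/3 perfect squares p² and q². The sides then
-- have lengths √3|p| and √3|q|, and m is p - q.
--
-- Real numbers occur only on the way to the norm equation. They are Cauchy sequences with termwise
-- operations, so a ring identity over ℝ can be checked over ℚ at each index. What is not termwise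
-- is the value of a square root: `√≈` rounds, and its square is right only in the limit. The
-- argument is therefore arranged so that √N, √N′ and √3 finally occur only squared. The result is
-- an equation between constant sequences, which descends to ℚ and from there to ℤ.

coprime-squares : ∀ {m n} → Coprime m n → m ℕ.* m ∣ n ℕ.* n → m ≡ 1
coprime-squares {m} {n} c m²∣n² = c (ℕ.∣-refl ,
  coprime-divisor c (ℕ.∣-trans (ℕ.m∣m*n m) m²∣n²))

-- Division by the gcd leaves coprime numbers whose squares still divide, so `coprime-squares` makes
-- `m` equal to the gcd. The hypothesis `m ≢ 0` keeps the gcd nonzero, hence cancellable.
square-∣⇒∣ : ∀ m n → m ≢ 0 → m ℕ.* m ∣ n ℕ.* n → m ∣ n
square-∣⇒∣ m n m≢0 m²∣n² = subst (_∣ n) (sym m≡g) (gcd[m,n]∣n m n)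
  where
  g : ℕ
  g = gcd m n
  instance
    g≢0 : ℕ.NonZero g
    g≢0 = ℕ.≢-nonZero (gcd[m,n]≢0 m n (inj₁ m≢0))
    g²≢0 : ℕ.NonZero (g ℕ.* g)
    g²≢0 = ℕₚ.m*n≢0 g g
  square-/g : ∀ k → g ∣ k → k ℕ.* k ≡ g ℕ.* g ℕ.* (k ℕ./ g ℕ.* (k ℕ./ g))
  square-/g k g∣k = trans (cong (λ j → j ℕ.* j) (sym (ℕ.m*[n/m]≡n g∣k)))
    (ℕₚ.[m*n]*[o*p]≡[m*o]*[n*p] g (k ℕ./ g) g (k ℕ./ g))
  m/g≡1 : m ℕ./ g ≡ 1
  m/g≡1 = coprime-squares (coprime-/gcd m n) (ℕ.*-cancelˡ-∣ (g ℕ.* g)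
    (subst₂ _∣_ (square-/g m (gcd[m,n]∣m m n)) (square-/g n (gcd[m,n]∣n m n)) m²∣n²))
  m≡g : m ≡ g
  m≡g = trans (sym (ℕ.m*[n/m]≡n (gcd[m,n]∣m m n)))
    (trans (cong (g ℕ.*_) m/g≡1) (ℕₚ.*-identityʳ g))

module _ where
  open import Data.Integer.Base using (+_; _+_; _-_; _*_; -_; ∣_∣)
  open ℤ-Solver.+-*-Solver

  i²≡j²n⇒j∣i : ∀ i j n → j ≢ + 0 → i * i ≡ j * j * n → j ℤ∣.∣ i
  i²≡j²n⇒j∣i i j n j≢0 i²≡j²n = ℤ∣.∣ᵤ⇒∣ (square-∣⇒∣ ∣ j ∣ ∣ i ∣
    (λ e → j≢0 (ℤₚ.∣i∣≡0⇒i≡0 e))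
    (subst₂ _∣_ (ℤₚ.abs-* j j) (trans (cong ∣_∣ (sym i²≡j²n)) (ℤₚ.abs-* i i))
      (divides ∣ n ∣ (trans (ℤₚ.abs-* (j * j) n) (ℕₚ.*-comm ∣ j * j ∣ ∣ n ∣)))))

  -- A rational square root i/j of an integer is an integer. This is how N/3 and N′/3 are recognised
  -- as perfect squares.
  i²≡j²n⇒√ : ∀ i j n → j ≢ + 0 → i * i ≡ j * j * n → ∃ λ p → i ≡ j * p × p * p ≡ n
  i²≡j²n⇒√ i j n j≢0 i²≡j²n = p , i≡jp ,
    ℤₚ.*-cancelˡ-≡ (j * j) (p * p) n {{ℤₚ.i*j≢0 j j {{ℤ.≢-nonZero j≢0}} {{ℤ.≢-nonZero j≢0}}}} (begin
      j * j * (p * p)   ≡⟨ solve 2 (λ j p → j :* j :* (p :* p) := j :* p :* (j :* p)) refl j p ⟩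
      j * p * (j * p)   ≡⟨ cong (λ k → k * k) i≡jp ⟨
      i * i             ≡⟨ i²≡j²n ⟩
      j * j * n         ∎)
    where
    open ≡-Reasoning
    j∣i : j ℤ∣.∣ i
    j∣i = i²≡j²n⇒j∣i i j n j≢0 i²≡j²n
    p : ℤ
    p = ℤ∣.quotient j∣i
    i≡jp : i ≡ j * p
    i≡jp = trans (ℤ∣._∣_.equality j∣i) (ℤₚ.*-comm p j)

  prime-∣*⇒∣⊎∣ : ∀ {p} → Prime p → ∀ i j → + p ℤ∣.∣ i * j → + p ℤ∣.∣ i ⊎ + p ℤ∣.∣ j
  prime-∣*⇒∣⊎∣ {p} p-prime i j p∣ij = ⊎.map ℤ∣.∣ᵤ⇒∣ ℤ∣.∣ᵤ⇒∣ (euclidsLemma ∣ i ∣ ∣ j ∣ p-prime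
    (subst (p ∣_) (ℤₚ.abs-* i j) (ℤ∣.∣⇒∣ᵤ p∣ij)))

  prime-∣²⇒∣ : ∀ {p} → Prime p → ∀ i → + p ℤ∣.∣ i * i → + p ℤ∣.∣ i
  prime-∣²⇒∣ p-prime i p∣i² = [ id , id ]′ (prime-∣*⇒∣⊎∣ p-prime i i p∣i²)

  -- Insolubility of (9y² - 16)(k² - m²) = 48y²

  -- If k² - m² is even, then so is (k - m)², hence k - m and also k + m; their product is then
  -- divisible by 4.
  k²-m²≢6 : ∀ k m → k * k - m * m ≢ + 6
  k²-m²≢6 k m eq = odd (prime-∣²⇒∣ (from-yes (prime? 2)) (k - m) (ℤ∣.divides (+ 3 - m * (k - m)) (begin
    (k - m) * (k - m)                           ≡⟨ solve 2 (λ k m → (k :- m) :* (k :- m)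
      := (k :* k :- m :* m) :- m :* (k :- m) :* con (+ 2)) refl k m ⟩
    (k * k - m * m) - m * (k - m) * + 2         ≡⟨ cong (_- m * (k - m) * + 2) eq ⟩
    + 3 * + 2 - m * (k - m) * + 2               ≡⟨ solve 1 (λ n → con (+ 3) :* con (+ 2) :- n :* con (+ 2)
      := (con (+ 3) :- n) :* con (+ 2)) refl (m * (k - m)) ⟩
    (+ 3 - m * (k - m)) * + 2                   ∎)))
    where
    open ≡-Reasoning
    odd : ¬ (+ 2 ℤ∣.∣ k - m)
    odd (ℤ∣.divides j k-m≡2j) = from-no (4 ∣? 6) (ℤ∣.∣⇒∣ᵤ {+ 4} {+ 6} (ℤ∣.divides (j * (j + m)) (begin
      + 6                           ≡⟨ eq ⟨
      k * k - m * m                 ≡⟨ solve 2 (λ k m → k :* k :- m :* m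
        := (k :- m) :* (k :- m :+ con (+ 2) :* m)) refl k m ⟩
      (k - m) * (k - m + + 2 * m)   ≡⟨ cong (λ i → i * (i + + 2 * m)) k-m≡2j ⟩
      j * + 2 * (j * + 2 + + 2 * m) ≡⟨ solve 2 (λ j m → j :* con (+ 2) :* (j :* con (+ 2) :+ con (+ 2) :* m)
        := j :* (j :+ m) :* con (+ 4)) refl j m ⟩
      j * (j + m) * + 4             ∎)))

  -- The quotient `t` is known only through its product with the denominator `E`, so both bounds
  -- arrive multiplied by `E`. Once it is cancelled, t - 5 and 6 - t are at least 1, yet their sum
  -- is 1.
  no-integer-in-⟨5,6⟩ : ∀ t {E} → + 0 ℤ.< E → + 0 ℤ.< (t - + 5) * E → + 0 ℤ.< (+ 6 - t) * E → ⊥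
  no-integer-in-⟨5,6⟩ t {E} 0<E 0<₅ 0<₆ = from-no (2 ℕₚ.≤? 1) (ℤₚ.drop‿+≤+ (subst (+ 2 ℤ.≤_)
    (solve 1 (λ t → (t :- con (+ 5)) :+ (con (+ 6) :- t) := con (+ 1)) refl t)
    (ℤₚ.+-mono-≤ (ℤₚ.i<j⇒suc[i]≤j (cancel (t - + 5) 0<₅)) (ℤₚ.i<j⇒suc[i]≤j (cancel (+ 6 - t) 0<₆)))))
    where
    cancel : ∀ i → + 0 ℤ.< i * E → + 0 ℤ.< i
    cancel i 0<iE = ℤₚ.*-cancelʳ-<-nonNeg E {{ℤ.nonNegative (ℤₚ.<⇒≤ 0<E)}} 0<iE

  affine-pos : ∀ a b r → + 0 ℤ.< + suc a + + b * + r
  affine-pos a b r = subst (λ i → + 0 ℤ.< + suc a + i) (ℤₚ.pos-* b r)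
    (ℤ.+<+ (s≤s z≤n))

  -- The quotient k² - m² = 48y²/(9y² - 16) lies strictly between 5 and 6 as soon as |y| > 4.
  quotient-insoluble : ∀ n k m → n ≢ 0 → (+ 9 * (+ n * + n) - + 16) * (k * k - m * m) ≢ + 48 * (+ n * + n)
  quotient-insoluble 0 k m n≢0 _ = n≢0 refl
  -- At a numeral both coefficients compute, and `eq` becomes a divisibility: -7 into 48, 20 into
  -- 192, 65 into 432. All three fail, whereas 4 gives 128 into 768 with quotient 6.
  quotient-insoluble 1 k m _ eq = from-no (7 ∣? 48) (ℤ∣.∣⇒∣ᵤ {ℤ.- + 7} {+ 48}
    (ℤ∣.divides (k * k - m * m) (trans (sym eq) (ℤₚ.*-comm (ℤ.- + 7) (k * k - m * m)))))
  quotient-insoluble 2 k m _ eq = from-no (20 ∣? 192) (ℤ∣.∣⇒∣ᵤ {+ 20} {+ 192}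
    (ℤ∣.divides (k * k - m * m) (trans (sym eq) (ℤₚ.*-comm (+ 20) (k * k - m * m)))))
  quotient-insoluble 3 k m _ eq = from-no (65 ∣? 432) (ℤ∣.∣⇒∣ᵤ {+ 65} {+ 432}
    (ℤ∣.divides (k * k - m * m) (trans (sym eq) (ℤₚ.*-comm (+ 65) (k * k - m * m)))))
  quotient-insoluble 4 k m _ eq = k²-m²≢6 k m (ℤₚ.*-cancelˡ-≡ (+ 128) (k * k - m * m) (+ 6) eq)
  quotient-insoluble (suc (suc (suc (suc (suc j))))) k m _ eq = no-integer-in-⟨5,6⟩ t
    -- With n² = 25 + r, the three quantities E, 48n² - 5E and 6E - 48n² are 209 + 9r, 155 + 3r and
    -- 54 + 6r. `affine-pos` takes the predecessor of the constant term, hence 208, 154 and 53.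
    (subst (+ 0 ℤ.<_) (sym E≡) (affine-pos 208 9 r))
    (subst (+ 0 ℤ.<_) (begin
      + 155 + + 3 * + r           ≡⟨ solve 1 (λ r → con (+ 155) :+ con (+ 3) :* r
        := con (+ 48) :* (con (+ 25) :+ r) :- con (+ 5) :* (con (+ 209) :+ con (+ 9) :* r)) refl (+ r) ⟩
      + 48 * (+ 25 + + r) - + 5 * (+ 209 + + 9 * + r) ≡⟨ cong₂ (λ s e → + 48 * s - + 5 * e) n²≡ E≡ ⟨
      + 48 * (n * n) - + 5 * E    ≡⟨ cong (_- + 5 * E) eq ⟨
      E * t - + 5 * E             ≡⟨ solve 2 (λ e t → e :* t :- con (+ 5) :* e := (t :- con (+ 5)) :* e) refl E t ⟩
      (t - + 5) * E               ∎)
      (affine-pos 154 3 r))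
    (subst (+ 0 ℤ.<_) (begin
      + 54 + + 6 * + r           ≡⟨ solve 1 (λ r → con (+ 54) :+ con (+ 6) :* r
        := con (+ 6) :* (con (+ 209) :+ con (+ 9) :* r) :- con (+ 48) :* (con (+ 25) :+ r)) refl (+ r) ⟩
      + 6 * (+ 209 + + 9 * + r) - + 48 * (+ 25 + + r) ≡⟨ cong₂ (λ s e → + 6 * e - + 48 * s) n²≡ E≡ ⟨
      + 6 * E - + 48 * (n * n)   ≡⟨ cong (λ i → + 6 * E - i) eq ⟨
      + 6 * E - E * t            ≡⟨ solve 2 (λ e t → con (+ 6) :* e :- e :* t := (con (+ 6) :- t) :* e) refl E t ⟩
      (+ 6 - t) * E              ∎)
      (affine-pos 53 6 r))
    where
    open ≡-Reasoning
    n t E : ℤ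
    n = + (5 ℕ.+ j)
    t = k * k - m * m
    E = + 9 * (n * n) - + 16
    r : ℕ
    r = 10 ℕ.* j ℕ.+ j ℕ.* j
    n²≡ : n * n ≡ + 25 + + r
    n²≡ = begin
      (+ 5 + + j) * (+ 5 + + j)             ≡⟨ solve 1 (λ j → (con (+ 5) :+ j) :* (con (+ 5) :+ j)
        := con (+ 25) :+ (con (+ 10) :* j :+ j :* j)) refl (+ j) ⟩
      + 25 + (+ 10 * + j + + j * + j)       ≡⟨ cong (λ s → + 25 + s) (cong₂ _+_ (ℤₚ.pos-* 10 j) (ℤₚ.pos-* j j)) ⟨
      + 25 + + r                            ∎
    E≡ : E ≡ + 209 + + 9 * + r
    E≡ = trans (cong (λ s → + 9 * s - + 16) n²≡)
      (solve 1 (λ r → con (+ 9) :* (con (+ 25) :+ r) :- con (+ 16) := con (+ 209) :+ con (+ 9) :* r) refl (+ r))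

  -- From the norm equation to the quotient equation

  -- |a + bω|²
  norm : ℤ → ℤ → ℤ
  norm a b = a * a - a * b + b * b

  i²≡∣i∣² : ∀ i → i * i ≡ + ∣ i ∣ * + ∣ i ∣
  i²≡∣i∣² (+ n)        = refl
  i²≡∣i∣² ℤ.-[1+ n ] = refl

  quotient-insoluble-ℤ : ∀ y k m → y ≢ + 0 → (+ 9 * (y * y) - + 16) * (k * k - m * m) ≢ + 48 * (y * y)
  quotient-insoluble-ℤ y k m y≢0 eq = quotient-insoluble ∣ y ∣ k m (λ e → y≢0 (ℤₚ.∣i∣≡0⇒i≡0 e))
    (subst (λ s → (+ 9 * s - + 16) * (k * k - m * m) ≡ + 48 * s) (i²≡∣i∣² y) eq)

  *-cancelˡ-≢0 : ∀ i {j k} → i ≢ + 0 → i * j ≡ i * k → j ≡ k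
  *-cancelˡ-≢0 i {j} {k} i≢0 = ℤₚ.*-cancelˡ-≡ i j k {{ℤ.≢-nonZero i≢0}}

  -- With s = kx² + 16l one has e = 3ks - 32n, so the terms in n² cancel and e² - 1024nn′ = 3k²(3s²
  -- - 64x²n).
  reduced-equation : ∀ k x l n → k ≢ + 0 →
    let D = k * x ; n′ = n - + 3 * (k * l) ; e = + 3 * (D * D) - + 16 * (n + n′) in
    e * e ≡ + 1024 * (n * n′) →
    + 3 * ((k * x * x + + 16 * l) * (k * x * x + + 16 * l)) ≡ + 64 * (x * x) * n
  reduced-equation k x l n k≢0 eq = *-cancelˡ-≢0 k k≢0 (*-cancelˡ-≢0 k k≢0 (*-cancelˡ-≢0 (+ 3) (λ ())
    (ℤₚ.i-j≡0⇒i≡j _ _ (begin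
    + 3 * (k * (k * (+ 3 * (s * s)))) - + 3 * (k * (k * (+ 64 * (x * x) * n)))
      ≡⟨ solve 4 (λ k x l n →
        let D  = k :* x
            n′ = n :- con (+ 3) :* (k :* l)
            e  = con (+ 3) :* (D :* D) :- con (+ 16) :* (n :+ n′)
            s  = k :* x :* x :+ con (+ 16) :* l
        in con (+ 3) :* (k :* (k :* (con (+ 3) :* (s :* s)))) :- con (+ 3) :* (k :* (k :* (con (+ 64) :* (x :* x) :* n)))
          := e :* e :- con (+ 1024) :* (n :* n′)) refl k x l n ⟩
    e * e - + 1024 * (n * n′)
      ≡⟨ ℤₚ.i≡j⇒i-j≡0 eq ⟩
    + 0 ∎))))
    where
    open ≡-Reasoning
    s n′ e : ℤ
    s = k * x * x + + 16 * l
    n′ = n - + 3 * (k * l)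
    e = + 3 * (k * x * (k * x)) - + 16 * (n + n′)

  -- Modulo 3 the equation reads 16x⁴ ≡ 0. The factor x² + 3b² is four times the norm of a + bω when
  -- x = 2a - b.
  3s²≡16x²[x²+3b²]⇒3∣x : ∀ s x b → + 3 * (s * s) ≡ + 16 * (x * x) * (x * x + + 3 * (b * b)) → + 3 ℤ∣.∣ x
  3s²≡16x²[x²+3b²]⇒3∣x s x b eq = prime-∣²⇒∣ 3-prime x (prime-∣²⇒∣ 3-prime (x * x) ([ (λ 3∣16 → contradiction (ℤ∣.∣⇒∣ᵤ 3∣16) (from-no (3 ∣? 16))) , id ]′
    (prime-∣*⇒∣⊎∣ 3-prime (+ 16) (x * x * (x * x)) (ℤ∣.divides (s * s - + 16 * (x * x * (b * b))) (begin
      + 16 * (x * x * (x * x))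
        ≡⟨ solve 2 (λ x b → con (+ 16) :* (x :* x :* (x :* x)) := con (+ 16) :* (x :* x) :* (x :* x :+ con (+ 3) :* (b :* b))
          :- con (+ 48) :* (x :* x :* (b :* b))) refl x b ⟩
      + 16 * (x * x) * (x * x + + 3 * (b * b)) - + 48 * (x * x * (b * b))
        ≡⟨ cong (_- + 48 * (x * x * (b * b))) eq ⟨
      + 3 * (s * s) - + 48 * (x * x * (b * b))
        ≡⟨ solve 3 (λ s x b → con (+ 3) :* (s :* s) :- con (+ 48) :* (x :* x :* (b :* b))
          := (s :* s :- con (+ 16) :* (x :* x :* (b :* b))) :* con (+ 3)) refl s x b ⟩
      (s * s - + 16 * (x * x * (b * b))) * + 3 ∎)))))
    where
    open ≡-Reasoning
    3-prime : Prime 3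
    3-prime = from-yes (prime? 3)

  -- The squares of s and t = kx² - 16l are both divisible by (8x)², so s = 8xp and t = 8xq;
  -- then m = p - q satisfies 4l = xm and (9y² - 16)(k² - m²) = 48y².
  no-solution : ∀ a y k → y ≢ + 0 →
    let x = y * + 3 ; l = + 2 * a - x - k ; s = k * x * x + + 16 * l in
    s * s ≢ + 8 * x * (+ 8 * x) * (a * a - + 3 * a * y + + 3 * y * y)
  no-solution a y k y≢0 eq = conclude √s √t
    where
    open ≡-Reasoning
    x l n s t : ℤ
    x = y * + 3
    l = + 2 * a - x - k
    -- This is N/3 for b = 2a - 3y, and `n - k * l` is N′/3.
    n = a * a - + 3 * a * y + + 3 * y * y
    s = k * x * x + + 16 * l
    t = k * x * x - + 16 * l
    x≢0 : x ≢ + 0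
    x≢0 e = [ y≢0 , (λ ()) ]′ (ℤₚ.i*j≡0⇒i≡0∨j≡0 y e)
    8x≢0 : + 8 * x ≢ + 0
    8x≢0 e = [ (λ ()) , x≢0 ]′ (ℤₚ.i*j≡0⇒i≡0∨j≡0 (+ 8) e)
    eq′ : t * t ≡ + 8 * x * (+ 8 * x) * (n - k * l)
    eq′ = begin
      t * t
        ≡⟨ solve 3 (λ k x l → let s = k :* x :* x :+ con (+ 16) :* l ; t = k :* x :* x :- con (+ 16) :* l in
          t :* t := s :* s :- con (+ 64) :* (x :* x) :* (k :* l)) refl k x l ⟩
      s * s - + 64 * (x * x) * (k * l)
        ≡⟨ cong (_- + 64 * (x * x) * (k * l)) eq ⟩
      + 8 * x * (+ 8 * x) * n - + 64 * (x * x) * (k * l)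
        ≡⟨ solve 3 (λ x n z → con (+ 8) :* x :* (con (+ 8) :* x) :* n :- con (+ 64) :* (x :* x) :* z
          := con (+ 8) :* x :* (con (+ 8) :* x) :* (n :- z)) refl x n (k * l) ⟩
      + 8 * x * (+ 8 * x) * (n - k * l) ∎
    √s : ∃ λ p → s ≡ + 8 * x * p × p * p ≡ n
    √s = i²≡j²n⇒√ s (+ 8 * x) n 8x≢0 eq
    √t : ∃ λ q → t ≡ + 8 * x * q × q * q ≡ n - k * l
    √t = i²≡j²n⇒√ t (+ 8 * x) (n - k * l) 8x≢0 eq′
    conclude : (∃ λ p → s ≡ + 8 * x * p × p * p ≡ n) → ¬ (∃ λ q → t ≡ + 8 * x * q × q * q ≡ n - k * l)
    conclude (p , s≡8xp , p²≡n) (q , t≡8xq , _) = quotient-insoluble-ℤ y k m y≢0 (ℤₚ.i-j≡0⇒i≡j _ _ (begin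
      (+ 9 * (y * y) - + 16) * (k * k - m * m) - + 48 * (y * y)
        -- The cross terms 8kxm cancel, so the two squares differ by (x² - 16)(k² - m²), where x² =
        -- 9y².
        ≡⟨ solve 4 (λ a y k m → let x = y :* con (+ 3) in
          (con (+ 9) :* (y :* y) :- con (+ 16)) :* (k :* k :- m :* m) :- con (+ 48) :* (y :* y)
          := (k :* x :+ con (+ 4) :* m) :* (k :* x :+ con (+ 4) :* m)
             :- (con (+ 48) :* (y :* y) :+ (con (+ 4) :* k :+ x :* m) :* (con (+ 4) :* k :+ x :* m))) refl a y k m ⟩
      (k * x + + 4 * m) * (k * x + + 4 * m) - (+ 48 * (y * y) + (+ 4 * k + x * m) * (+ 4 * k + x * m))
        ≡⟨ cong₂ (λ u v → u * u - (+ 48 * (y * y) + (+ 4 * k + v) * (+ 4 * k + v))) (sym 8p≡) (sym 4l≡xm) ⟩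
      + 8 * p * (+ 8 * p) - (+ 48 * (y * y) + (+ 4 * k + + 4 * l) * (+ 4 * k + + 4 * l))
        -- Completing the square gives 4n = (2a - 3y)² + 3y², and 2a - 3y = k + l.
        ≡⟨ solve 4 (λ a y k p → let l = con (+ 2) :* a :- y :* con (+ 3) :- k in
          con (+ 8) :* p :* (con (+ 8) :* p)
            :- (con (+ 48) :* (y :* y) :+ (con (+ 4) :* k :+ con (+ 4) :* l) :* (con (+ 4) :* k :+ con (+ 4) :* l))
          := con (+ 64) :* (p :* p :- (a :* a :- con (+ 3) :* a :* y :+ con (+ 3) :* y :* y))) refl a y k p ⟩
      + 64 * (p * p - n)
        ≡⟨ cong (λ i → + 64 * i) (ℤₚ.i≡j⇒i-j≡0 p²≡n) ⟩
      + 0 ∎))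
      where
      m : ℤ
      m = p - q
      4l≡xm : + 4 * l ≡ x * m
      4l≡xm = *-cancelˡ-≢0 (+ 8) (λ ()) (begin
        + 8 * (+ 4 * l)
          ≡⟨ solve 2 (λ z l → con (+ 8) :* (con (+ 4) :* l) := z :+ con (+ 16) :* l :- (z :- con (+ 16) :* l)) refl (k * x * x) l ⟩
        s - t
          ≡⟨ cong₂ _-_ s≡8xp t≡8xq ⟩
        + 8 * x * p - + 8 * x * q
          ≡⟨ solve 3 (λ x p q → con (+ 8) :* x :* p :- con (+ 8) :* x :* q := con (+ 8) :* (x :* (p :- q))) refl x p q ⟩
        + 8 * (x * m) ∎)
      8p≡ : + 8 * p ≡ k * x + + 4 * m
      8p≡ = *-cancelˡ-≢0 x x≢0 (begin
        x * (+ 8 * p)                     ≡⟨ solve 2 (λ x p → x :* (con (+ 8) :* p) := con (+ 8) :* x :* p) refl x p ⟩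
        + 8 * x * p                       ≡⟨ s≡8xp ⟨
        k * x * x + + 16 * l              ≡⟨ solve 2 (λ z l → z :+ con (+ 16) :* l := z :+ con (+ 4) :* (con (+ 4) :* l)) refl (k * x * x) l ⟩
        k * x * x + + 4 * (+ 4 * l)       ≡⟨ cong (λ i → k * x * x + + 4 * i) 4l≡xm ⟩
        k * x * x + + 4 * (x * m)         ≡⟨ solve 3 (λ k x m → k :* x :* x :+ con (+ 4) :* (x :* m)
          := x :* (k :* x :+ con (+ 4) :* m)) refl k x m ⟩
        x * (k * x + + 4 * m)             ∎)

  norm-equation-insoluble : ∀ a b c d → + 2 * (a + c) ≡ b + d → a * d - b * c ≢ + 0 →
    let D = a * d - b * c ; e = + 3 * (D * D) - + 16 * (norm a b + norm c d) in
    e * e ≢ + 1024 * (norm a b * norm c d)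
  norm-equation-insoluble a b c d vertical D≢0 eq = conclude 3∣x
    where
    open ≡-Reasoning
    k x l s D : ℤ
    k = a + c
    x = + 2 * a - b
    l = b - k
    s = k * x * x + + 16 * l
    D = a * d - b * c
    -- With `b` eliminated through b = 2a - x, `s` becomes a function of `x` in which x = 3y can be
    -- substituted.
    s′ : ℤ → ℤ
    s′ x = k * x * x + + 16 * (+ 2 * a - x - k)
    b≡2a-x : b ≡ + 2 * a - x
    b≡2a-x = solve 2 (λ a b → b := con (+ 2) :* a :- (con (+ 2) :* a :- b)) refl a b
    d≡2k-b : d ≡ + 2 * k - b
    d≡2k-b = trans (solve 2 (λ b d → d := b :+ d :- b) refl b d) (cong (_- b) (sym vertical))
    D≡kx : D ≡ k * x
    D≡kx = trans (cong (λ d → a * d - b * c) d≡2k-b)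
      (solve 3 (λ a b c → a :* (con (+ 2) :* (a :+ c) :- b) :- b :* c := (a :+ c) :* (con (+ 2) :* a :- b)) refl a b c)
    norm-cd : norm c d ≡ norm a b - + 3 * (k * l)
    norm-cd = trans (cong (norm c) d≡2k-b)
      (solve 3 (λ a b c → let k = a :+ c ; d = con (+ 2) :* k :- b in
        c :* c :- c :* d :+ d :* d := a :* a :- a :* b :+ b :* b :- con (+ 3) :* (k :* (b :- k))) refl a b c)
    k≢0 : k ≢ + 0
    k≢0 e = D≢0 (trans D≡kx (cong (_* x) e))
    x≢0 : x ≢ + 0
    x≢0 e = D≢0 (trans D≡kx (trans (cong (k *_) e) (ℤₚ.*-zeroʳ k)))
    reduced : + 3 * (s * s) ≡ + 64 * (x * x) * norm a b
    reduced = reduced-equation k x l (norm a b) k≢0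
      (subst₂ (λ D n′ → let e = + 3 * (D * D) - + 16 * (norm a b + n′) in e * e ≡ + 1024 * (norm a b * n′))
        D≡kx norm-cd eq)
    3∣x : + 3 ℤ∣.∣ x
    3∣x = 3s²≡16x²[x²+3b²]⇒3∣x s x b (trans reduced
      (solve 2 (λ a b → let x = con (+ 2) :* a :- b in con (+ 64) :* (x :* x) :* (a :* a :- a :* b :+ b :* b)
        := con (+ 16) :* (x :* x) :* (x :* x :+ con (+ 3) :* (b :* b))) refl a b))
    conclude : ¬ (+ 3 ℤ∣.∣ x)
    conclude (ℤ∣.divides y x≡3y) = no-solution a y k y≢0 (*-cancelˡ-≢0 (+ 3) (λ ()) (begin
      + 3 * (s′ (y * + 3) * s′ (y * + 3))
        ≡⟨ cong (λ x → + 3 * (s′ x * s′ x)) x≡3y ⟨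
      + 3 * (s′ x * s′ x)
        ≡⟨ cong (λ b → + 3 * ((k * x * x + + 16 * (b - k)) * (k * x * x + + 16 * (b - k)))) b≡2a-x ⟨
      + 3 * (s * s)
        ≡⟨ reduced ⟩
      + 64 * (x * x) * norm a b
        ≡⟨ cong₂ (λ x b → + 64 * (x * x) * norm a b) x≡3y (trans b≡2a-x (cong (λ x → + 2 * a - x) x≡3y)) ⟩
      + 64 * (y * + 3 * (y * + 3)) * norm a (+ 2 * a - y * + 3)
        -- The norm turns into 3(a² - 3ay + 3y²), which supplies the factor 3 to be cancelled.
        ≡⟨ solve 2 (λ a y → let x = y :* con (+ 3) ; b = con (+ 2) :* a :- x in
          con (+ 64) :* (x :* x) :* (a :* a :- a :* b :+ b :* b)
          := con (+ 3) :* (con (+ 8) :* x :* (con (+ 8) :* x) :* (a :* a :- con (+ 3) :* a :* y :+ con (+ 3) :* y :* y)))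
          refl a y ⟩
      + 3 * (+ 8 * (y * + 3) * (+ 8 * (y * + 3)) * (a * a - + 3 * a * y + + 3 * y * y)) ∎))
      where
      y≢0 : y ≢ + 0
      y≢0 e = x≢0 (trans x≡3y (cong (_* + 3) e))

  -- Passing from v to -v negates D and fixes both norms, and the equation contains D only squared.
  norm-equation-insoluble′ : ∀ a b c d → + 2 * (a + - c) ≡ b + - d → a * d - b * c ≢ + 0 →
    let D = a * d - b * c ; e = + 3 * (D * D) - + 16 * (norm a b + norm c d) in
    e * e ≢ + 1024 * (norm a b * norm c d)
  norm-equation-insoluble′ a b c d vertical D≢0 eq = norm-equation-insoluble a b (- c) (- d) vertical
    (λ D′≡0 → D≢0 (trans (sym (ℤₚ.neg-involutive D)) (cong -_ (trans (sym D′≡-D) D′≡0))))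
    (subst₂ (λ s n → let e = + 3 * s - + 16 * (norm a b + n) in e * e ≡ + 1024 * (norm a b * n))
      D²≡D′² norm≡ eq)
    where
    D D′ : ℤ
    D = a * d - b * c
    D′ = a * - d - b * - c
    D′≡-D : D′ ≡ - D
    D′≡-D = solve 4 (λ a b c d → a :* :- d :- b :* :- c := :- (a :* d :- b :* c)) refl a b c d
    D²≡D′² : D * D ≡ D′ * D′
    D²≡D′² = trans (solve 1 (λ D → D :* D := :- D :* :- D) refl D) (cong (λ i → i * i) (sym D′≡-D))
    norm≡ : norm c d ≡ norm (- c) (- d)
    norm≡ = solve 2 (λ c d → c :* c :- c :* d :+ d :* d := :- c :* :- c :- :- c :* :- d :+ :- d :* :- d) refl c d

-- The setoid of real numbers

open import Data.Rational.Base hiding (_≃_)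
open import Data.Rational.Properties hiding (≃-sym)
open ℚ-Solver.+-*-Solver using (solve; _:+_; _:*_; :-_; _:-_; _:=_; con)

-- A record rather than the function type _≃_ itself, so that both sides can be inferred.
record _≈_ (x y : ℝ) : Set where
  constructor ≃⇒≈
  field ≈⇒≃ : x ≃ y

open _≈_ public

infix 4 _≈_

-- Since the operations on ℝ act termwise, this reduces every ring identity over ℝ to the solver for
-- ℚ.
pointwise : ∀ {x y} → (∀ n → seq x n ≡ seq y n) → x ≈ y
pointwise {x} {y} x≡y = ≃⇒≈ λ ε 0<ε → 0 , λ n _ → subst (_< ε)
  (sym (trans (cong (λ q → ∣ seq x n - q ∣) (sym (x≡y n))) (cong ∣_∣ (+-inverseʳ (seq x n))))) 0<ε

≈-refl : ∀ {x} → x ≈ x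
≈-refl = pointwise (λ _ → refl)

≈-sym : ∀ {x y} → x ≈ y → y ≈ x
≈-sym {x} {y} (≃⇒≈ x≃y) = ≃⇒≈ λ ε 0<ε →
  let N , h = x≃y ε 0<ε
  in N , λ n n≥ → ∣-∣-sym {seq x n} {seq y n} (h n n≥)

≈-trans : ∀ {x y z} → x ≈ y → y ≈ z → x ≈ z
≈-trans {x} {y} {z} (≃⇒≈ x≃y) (≃⇒≈ y≃z) = ≃⇒≈ λ ε 0<ε →
  let M , h = x≃y (½ * ε) (*-pos {½} {ε} 0<½ 0<ε)
      N , k = y≃z (½ * ε) (*-pos {½} {ε} 0<½ 0<ε)
  in M ℕ.⊔ N , λ n n≥ → ≤-<-trans
    (subst (_≤ ∣ seq x n - seq y n ∣ + ∣ seq y n - seq z n ∣)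
      (cong ∣_∣ (solve 3 (λ p q r → (p :- q) :+ (q :- r) := p :- r) refl
        (seq x n) (seq y n) (seq z n)))
      (∣p+q∣≤∣p∣+∣q∣ (seq x n - seq y n) (seq y n - seq z n)))
    (+-halves< (h n (ℕₚ.m⊔n≤o⇒m≤o M N n≥)) (k n (ℕₚ.m⊔n≤o⇒n≤o M N n≥)))

≈-setoid : Setoid _ _
≈-setoid = record
  { Carrier = ℝ
  ; _≈_ = _≈_
  ; isEquivalence = record
    { refl = ≈-refl
    ; sym = ≈-sym
    ; trans = ≈-trans
    }
  }

+ʳ-cong : ∀ {x x′ y y′} → x ≈ x′ → y ≈ y′ → x +ʳ y ≈ x′ +ʳ y′
+ʳ-cong {x} {x′} {y} {y′} (≃⇒≈ x≃) (≃⇒≈ y≃) = ≃⇒≈ λ ε 0<ε →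
  let M , h = x≃ (½ * ε) (*-pos {½} {ε} 0<½ 0<ε)
      N , k = y≃ (½ * ε) (*-pos {½} {ε} 0<½ 0<ε)
  in M ℕ.⊔ N , λ n n≥ → ≤-<-trans
    (subst (_≤ ∣ seq x n - seq x′ n ∣ + ∣ seq y n - seq y′ n ∣)
      (cong ∣_∣ (solve 4 (λ a b c d → (a :- c) :+ (b :- d) := (a :+ b) :- (c :+ d)) refl
        (seq x n) (seq y n) (seq x′ n) (seq y′ n)))
      (∣p+q∣≤∣p∣+∣q∣ (seq x n - seq x′ n) (seq y n - seq y′ n)))
    (+-halves< (h n (ℕₚ.m⊔n≤o⇒m≤o M N n≥)) (k n (ℕₚ.m⊔n≤o⇒n≤o M N n≥)))

neg-cong : ∀ {x x′} → x ≈ x′ → -ʳ x ≈ -ʳ x′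
neg-cong {x} {x′} (≃⇒≈ x≃) = ≃⇒≈ λ ε 0<ε →
  let N , h = x≃ ε 0<ε
  in N , λ n n≥ → subst (_< ε)
    (cong ∣_∣ (solve 2 (λ a b → b :- a := :- a :- :- b) refl (seq x n) (seq x′ n)))
    (∣-∣-sym {seq x n} {seq x′ n} (h n n≥))

*ʳ-cong : ∀ {x x′ y y′} → x ≈ x′ → y ≈ y′ → x *ʳ y ≈ x′ *ʳ y′
*ʳ-cong {x} {x′} {y} {y′} (≃⇒≈ x≃) (≃⇒≈ y≃) = ≃⇒≈ λ ε 0<ε →
  let B , 0<B , L , b = cauchy-bounded {seq x} (cauchy x)
      B′ , 0<B′ , L′ , b′ = cauchy-bounded {seq y′} (cauchy y′)
      -- The product estimate yields only ≤ (B + B′)η; aiming at ½ε makes the final inequality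
      -- strict.
      η , 0<η , Bη≡½ε = divide {B + B′} {½ * ε} (+-mono-< 0<B 0<B′) (*-pos {½} {ε} 0<½ 0<ε)
      M , h = x≃ η 0<η
      M′ , h′ = y≃ η 0<η
      K = L ℕ.⊔ L′
      N = M ℕ.⊔ M′
  in K ℕ.⊔ N , λ n n≥ →
    let n≥K = ℕₚ.m⊔n≤o⇒m≤o K N n≥
        n≥N = ℕₚ.m⊔n≤o⇒n≤o K N n≥
    in ≤-<-trans
      (∣ab-cd∣-bound {seq x n} {seq y n} {seq x′ n} {seq y′ n}
        (b n (ℕₚ.m⊔n≤o⇒m≤o L L′ n≥K)) (b′ n (ℕₚ.m⊔n≤o⇒n≤o L L′ n≥K))
        (h′ n (ℕₚ.m⊔n≤o⇒n≤o M M′ n≥N)) (h n (ℕₚ.m⊔n≤o⇒m≤o M M′ n≥N)))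
      (subst (_< ε) (sym Bη≡½ε) (half< 0<ε))

sub-cong : ∀ {x x′ y y′} → x ≈ x′ → y ≈ y′ → x -ʳ y ≈ x′ -ʳ y′
sub-cong x≃ y≃ = +ʳ-cong x≃ (neg-cong y≃)

∣∣ʳ-cong : ∀ {x x′} → x ≈ x′ → ∣ x ∣ʳ ≈ ∣ x′ ∣ʳ
∣∣ʳ-cong {x} {x′} (≃⇒≈ x≃) = ≃⇒≈ λ ε 0<ε →
  let N , h = x≃ ε 0<ε
  in N , λ n n≥ → ∣-∣-nonexpansive {seq x n} {seq x′ n} (h n n≥)

-- A change of the argument by less than (½ε)² moves the root by less than ½ε, and rounding to the
-- mesh costs at most another ½ε.
√-cong : ∀ {x x′} → x ≈ x′ → √ x ≈ √ x′
√-cong {x} {x′} (≃⇒≈ x≃) = ≃⇒≈ λ ε 0<ε →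
  let 0<½ε = *-pos {½} {ε} 0<½ 0<ε
      0<½ε² = *-pos {½ * ε} {½ * ε} 0<½ε 0<½ε
      M , h = x≃ (½ * ε * (½ * ε)) 0<½ε²
      N , hN = archimedean (½ * ε) 0<½ε
      bound : ∀ n (p q : ℚ) → N ℕ.≤ n → ∣ p - q ∣ < ½ * ε * (½ * ε) →
        √≈ n (p ⊔ 0ℚ) < √≈ n (q ⊔ 0ℚ) + ε
      bound n p q n≥ d = √≈-modulus {n} {n} {q ⊔ 0ℚ} {p ⊔ 0ℚ} {ε}
        (p≤q⊔p q 0ℚ) (p≤q⊔p p 0ℚ) 0<ε (hN n n≥)
        (∣-∣<⇒<+ {p ⊔ 0ℚ} {q ⊔ 0ℚ} (⊔0-nonexpansive {p} {q} 0<½ε² d))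
  in M ℕ.⊔ N , λ n n≥ →
    let d = h n (ℕₚ.m⊔n≤o⇒m≤o M N n≥)
        n≥N = ℕₚ.m⊔n≤o⇒n≤o M N n≥
    in <+⇒∣-∣< {√≈ n (seq x n ⊔ 0ℚ)} {√≈ n (seq x′ n ⊔ 0ℚ)}
      (bound n (seq x n) (seq x′ n) n≥N d)
      (bound n (seq x′ n) (seq x n) n≥N (∣-∣-sym {seq x n} {seq x′ n} d))

-- Squares of square roots, and constants

mesh-cauchy : IsCauchy mesh
mesh-cauchy ε 0<ε =
  let N , h = archimedean (½ * ε) (*-pos {½} {ε} 0<½ 0<ε)
      bound : ∀ m n → N ℕ.≤ m → mesh m < mesh n + ε
      bound m n m≥ = ≤-<-trans (h m m≥) (<-trans (half< 0<ε)
        (subst (_< mesh n + ε) (+-identityˡ ε) (+-monoˡ-< ε (mesh>0 n))))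
  in N , λ m n m≥ n≥ → <+⇒∣-∣< {mesh m} {mesh n} (bound m n m≥) (bound n m n≥)

-- The bound on the rounding error of `√≈`, made a real number so that congruence can discard it.
meshʳ : ℝ
meshʳ = mkℝ mesh mesh-cauchy

meshʳ≈0 : meshʳ ≈ 0ʳ
meshʳ≈0 = ≃⇒≈ λ ε 0<ε →
  let N , h = archimedean (½ * ε) (*-pos {½} {ε} 0<½ 0<ε)
  in N , λ n n≥ → <+⇒∣-∣< {mesh n} {0ℚ}
    (subst (mesh n <_) (sym (+-identityˡ ε)) (≤-<-trans (h n n≥) (half< 0<ε)))
    (subst (_< mesh n + ε) (+-identityˡ 0ℚ) (+-mono-< (mesh>0 n) 0<ε))

≈-squeeze : ∀ {x y z} → (∀ n → seq x n ≤ seq y n) → (∀ n → seq y n ≤ seq z n) → x ≈ z → x ≈ y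
≈-squeeze {x} {y} {z} x≤y y≤z (≃⇒≈ x≃z) = ≃⇒≈ λ ε 0<ε →
  let N , h = x≃z ε 0<ε
  in N , λ n n≥ → <+⇒∣-∣< {seq x n} {seq y n}
    (≤-<-trans (x≤y n) (subst (_< seq y n + ε) (+-identityʳ (seq y n)) (+-monoʳ-< (seq y n) 0<ε)))
    (≤-<-trans (y≤z n) (∣-∣<⇒<+ {seq z n} {seq x n} (∣-∣-sym {seq x n} {seq z n} (h n n≥))))

-- At each index q lies between r² and (r + mesh)², and these two ends are the same real number.
√-square : ∀ q → 0ℚ ≤ q → √ (fromℚ q) *ʳ √ (fromℚ q) ≈ fromℚ q
√-square q 0≤q = ≈-squeeze {z = (r +ʳ meshʳ) *ʳ (r +ʳ meshʳ)}
  (λ n → subst (seq r n * seq r n ≤_) q⊔0 (√≈-lower n (q ⊔ 0ℚ) (p≤q⊔p q 0ℚ)))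
  (λ n → subst (_≤ (seq r n + mesh n) * (seq r n + mesh n)) q⊔0
    (<⇒≤ (√≈-upper n (q ⊔ 0ℚ) (p≤q⊔p q 0ℚ))))
  (*ʳ-cong r≈ r≈)
  where
  r : ℝ
  r = √ (fromℚ q)
  q⊔0 : q ⊔ 0ℚ ≡ q
  q⊔0 = p≥q⇒p⊔q≡p 0≤q
  r≈ : r ≈ r +ʳ meshʳ
  r≈ = ≈-trans {y = r +ʳ 0ʳ} (pointwise (λ n → sym (+-identityʳ (seq r n))))
    (+ʳ-cong ≈-refl (≈-sym meshʳ≈0))

fromℚ-injective : ∀ {p q} → fromℚ p ≈ fromℚ q → p ≡ q
fromℚ-injective {p} {q} (≃⇒≈ p≃q) with ∣ p - q ∣ ≟ 0ℚ
... | yes eq = p-q≡0⇒p≡q eq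
  where
  p-q≡0⇒p≡q : ∣ p - q ∣ ≡ 0ℚ → p ≡ q
  p-q≡0⇒p≡q e = trans (solve 2 (λ p q → p := (p :- q) :+ q) refl p q)
    (trans (cong (_+ q) (∣p∣≡0⇒p≡0 (p - q) e)) (+-identityˡ q))
... | no neq =
  -- For ε = ∣ p - q ∣ the constant difference would have to be smaller than itself.
  let N , h = p≃q ∣ p - q ∣ (≰⇒> (λ ≤0 → neq (≤-antisym ≤0 (0≤∣p∣ (p - q)))))
  in contradiction (h N ℕₚ.≤-refl) (<-irrefl refl)

-- The integers inside ℚ, and the norm form over ℚ

toℚᵘ-/1 : ∀ a → toℚᵘ (a / 1) ℚᵘ.≃ ℚᵘ.mkℚᵘ a 0
toℚᵘ-/1 a = toℚᵘ-fromℚᵘ (ℚᵘ.mkℚᵘ a 0)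

/1-homo-+ : ∀ a b → (a ℤ.+ b) / 1 ≡ a / 1 + b / 1
/1-homo-+ a b = toℚᵘ-injective (begin
  toℚᵘ ((a ℤ.+ b) / 1)                 ≈⟨ toℚᵘ-/1 (a ℤ.+ b) ⟩
  ℚᵘ.mkℚᵘ (a ℤ.+ b) 0                  ≈⟨ ℚᵘ.*≡* (cong (ℤ._* ℤ.+ 1)
    (sym (cong₂ ℤ._+_ (ℤₚ.*-identityʳ a) (ℤₚ.*-identityʳ b)))) ⟩
  ℚᵘ.mkℚᵘ a 0 ℚᵘ.+ ℚᵘ.mkℚᵘ b 0         ≈⟨ ℚᵘₚ.+-cong (toℚᵘ-/1 a) (toℚᵘ-/1 b) ⟨
  toℚᵘ (a / 1) ℚᵘ.+ toℚᵘ (b / 1)       ≈⟨ toℚᵘ-homo-+ (a / 1) (b / 1) ⟨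
  toℚᵘ (a / 1 + b / 1)                 ∎)
  where open import Relation.Binary.Reasoning.Setoid ℚᵘₚ.≃-setoid

/1-homo-* : ∀ a b → (a ℤ.* b) / 1 ≡ a / 1 * (b / 1)
/1-homo-* a b = toℚᵘ-injective (begin
  toℚᵘ ((a ℤ.* b) / 1)                 ≈⟨ toℚᵘ-/1 (a ℤ.* b) ⟩
  ℚᵘ.mkℚᵘ a 0 ℚᵘ.* ℚᵘ.mkℚᵘ b 0         ≈⟨ ℚᵘₚ.*-cong (toℚᵘ-/1 a) (toℚᵘ-/1 b) ⟨
  toℚᵘ (a / 1) ℚᵘ.* toℚᵘ (b / 1)       ≈⟨ toℚᵘ-homo-* (a / 1) (b / 1) ⟨
  toℚᵘ (a / 1 * (b / 1))               ∎)
  where open import Relation.Binary.Reasoning.Setoid ℚᵘₚ.≃-setoid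

/1-homo-neg : ∀ a → (ℤ.- a) / 1 ≡ - (a / 1)
/1-homo-neg a = toℚᵘ-injective (begin
  toℚᵘ ((ℤ.- a) / 1)      ≈⟨ toℚᵘ-/1 (ℤ.- a) ⟩
  ℚᵘ.- ℚᵘ.mkℚᵘ a 0        ≈⟨ ℚᵘₚ.-‿cong (toℚᵘ-/1 a) ⟨
  ℚᵘ.- toℚᵘ (a / 1)       ≈⟨ toℚᵘ-homo‿- (a / 1) ⟨
  toℚᵘ (- (a / 1))        ∎)
  where open import Relation.Binary.Reasoning.Setoid ℚᵘₚ.≃-setoid

/1-injective : ∀ {a b} → a / 1 ≡ b / 1 → a ≡ b
/1-injective {a} {b} eq with ℚᵘₚ.≃-trans (ℚᵘₚ.≃-sym (toℚᵘ-/1 a))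
  (ℚᵘₚ.≃-trans (toℚᵘ-cong eq) (toℚᵘ-/1 b))
... | ℚᵘ.*≡* a*1≡b*1 = trans (sym (ℤₚ.*-identityʳ a)) (trans a*1≡b*1 (ℤₚ.*-identityʳ b))

ι : ℕ → ℚ
ι n = ℤ.+ n / 1

normℚ : ℚ → ℚ → ℚ
normℚ α β = α * α - α * β + β * β

∣p∣²≡p² : ∀ p → ∣ p ∣ * ∣ p ∣ ≡ p * p
∣p∣²≡p² p with ∣p∣≡p∨∣p∣≡-p p
... | inj₁ eq = cong (λ q → q * q) eq
... | inj₂ eq = trans (cong (λ q → q * q) eq) (solve 1 (λ p → :- p :* :- p := p :* p) refl p)

0≤p² : ∀ p → 0ℚ ≤ p * p
0≤p² p = subst (0ℚ ≤_) (∣p∣²≡p² p) (square-mono {0ℚ} {∣ p ∣} ≤-refl (0≤∣p∣ p))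

-- Completing the square: the norm is (α - β/2)² + 3(β/2)².
0≤normℚ : ∀ α β → 0ℚ ≤ normℚ α β
0≤normℚ α β = subst (0ℚ ≤_)
  (solve 2 (λ α β → (α :- con ½ :* β) :* (α :- con ½ :* β) :+ con ½ :* β :* (con ½ :* β)
    :+ (con ½ :* β :* (con ½ :* β) :+ con ½ :* β :* (con ½ :* β))
    := α :* α :- α :* β :+ β :* β) refl α β)
  (+-mono-≤ (+-mono-≤ (0≤p² (α - ½ * β)) 0≤½β²) (+-mono-≤ 0≤½β² 0≤½β²))
  where
  0≤½β² : 0ℚ ≤ ½ * β * (½ * β)
  0≤½β² = 0≤p² (½ * β)

infix 4 _≈ᶜ_
_≈ᶜ_ : ℂ → ℂ → Set
z ≈ᶜ w = re z ≈ re w × im z ≈ im w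

≃ᶜ⇒≈ᶜ : ∀ {z w} → z ≃ᶜ w → z ≈ᶜ w
≃ᶜ⇒≈ᶜ (re≃ , im≃) = ≃⇒≈ re≃ , ≃⇒≈ im≃

≈ᶜ-trans : ∀ {z w v} → z ≈ᶜ w → w ≈ᶜ v → z ≈ᶜ v
≈ᶜ-trans (re₁ , im₁) (re₂ , im₂) = ≈-trans re₁ re₂ , ≈-trans im₁ im₂

sub-congᶜ : ∀ {z z′ w w′} → z ≈ᶜ z′ → w ≈ᶜ w′ → z -ᶜ w ≈ᶜ z′ -ᶜ w′
sub-congᶜ (re₁ , im₁) (re₂ , im₂) = sub-cong re₁ re₂ , sub-cong im₁ im₂

∧-cong : ∀ {z z′ w w′} → z ≈ᶜ z′ → w ≈ᶜ w′ → z ∧ w ≈ z′ ∧ w′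
∧-cong (re₁ , im₁) (re₂ , im₂) = sub-cong (*ʳ-cong re₁ im₂) (*ʳ-cong im₁ re₂)

√3 : ℝ
√3 = √ (fromℤ (ℤ.+ 3))

√3² : √3 *ʳ √3 ≈ fromℚ (ι 3)
√3² = √-square (ι 3) (nonNegative⁻¹ (ι 3))

-- Eisenstein coordinates

-- At `a / 1` and `b / 1` this unfolds to the form required by `_∈ℤ[ω]`; rational coordinates keep
-- it within reach of the solver for ℚ.
[_,_]ω : ℚ → ℚ → ℂ
[ α , β ]ω = (fromℚ α +i 0ʳ) +ᶜ (fromℚ β +i 0ʳ) *ᶜ ω

[]ω-sub : ∀ α β γ δ → [ γ , δ ]ω -ᶜ [ α , β ]ω ≈ᶜ [ γ - α , δ - β ]ω
[]ω-sub α β γ δ =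
  pointwise (λ n → solve 5 (λ α β γ δ h →
      γ :+ (δ :* con (- ½) :- con 0ℚ :* h) :- (α :+ (β :* con (- ½) :- con 0ℚ :* h))
      := γ :- α :+ ((δ :- β) :* con (- ½) :- con 0ℚ :* h))
    refl α β γ δ (½ * seq √3 n)) ,
  pointwise (λ n → solve 3 (λ β δ h →
      con 0ℚ :+ (δ :* h :+ con 0ℚ :* con (- ½)) :- (con 0ℚ :+ (β :* h :+ con 0ℚ :* con (- ½)))
      := con 0ℚ :+ ((δ :- β) :* h :+ con 0ℚ :* con (- ½)))
    refl β δ (½ * seq √3 n))

re-[]ω : ∀ α β → re [ α , β ]ω ≈ fromℚ (α - ½ * β)
re-[]ω α β = pointwise (λ n → solve 3 (λ α β h →
    α :+ (β :* con (- ½) :- con 0ℚ :* h) := α :- con ½ :* β) refl α β (½ * seq √3 n))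

im-[]ω : ∀ α β → im [ α , β ]ω ≈ fromℚ (½ * β) *ʳ √3
im-[]ω α β = pointwise (λ n → solve 2 (λ β t →
    con 0ℚ :+ (β :* (con ½ :* t) :+ con 0ℚ :* con (- ½)) := con ½ :* β :* t) refl β (seq √3 n))

-- The basis 1, ω spans a cell of area √3/2, by which the coordinate determinant is scaled.
[]ω-∧ : ∀ α β γ δ → [ α , β ]ω ∧ [ γ , δ ]ω ≈ fromℚ (½ * (α * δ - β * γ)) *ʳ √3
[]ω-∧ α β γ δ = ≈-trans
  (sub-cong (*ʳ-cong (re-[]ω α β) (im-[]ω γ δ)) (*ʳ-cong (im-[]ω α β) (re-[]ω γ δ)))
  (pointwise (λ n → solve 5 (λ α β γ δ t →
      (α :- con ½ :* β) :* (con ½ :* δ :* t) :- con ½ :* β :* t :* (γ :- con ½ :* δ)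
      := con ½ :* (α :* δ :- β :* γ) :* t)
    refl α β γ δ (seq √3 n)))

module ≈-Reasoning where
  open import Relation.Binary.Reasoning.Setoid ≈-setoid public

∣[]ω∣² : ∀ α β → let z = [ α , β ]ω in re z *ʳ re z +ʳ im z *ʳ im z ≈ fromℚ (normℚ α β)
∣[]ω∣² α β = begin
  re z *ʳ re z +ʳ im z *ʳ im z
    ≈⟨ +ʳ-cong (*ʳ-cong (re-[]ω α β) (re-[]ω α β)) (*ʳ-cong (im-[]ω α β) (im-[]ω α β)) ⟩
  fromℚ p *ʳ fromℚ p +ʳ (fromℚ q *ʳ √3) *ʳ (fromℚ q *ʳ √3)
    ≈⟨ pointwise (λ n → solve 3 (λ p q t → p :* p :+ q :* t :* (q :* t) := p :* p :+ q :* q :* (t :* t))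
         refl p q (seq √3 n)) ⟩
  fromℚ (p * p) +ʳ fromℚ (q * q) *ʳ (√3 *ʳ √3)
    -- No solver can do this step: the terms of `√3` are rational, so their squares reach 3 only in
    -- the limit.
    ≈⟨ +ʳ-cong ≈-refl (*ʳ-cong ≈-refl √3²) ⟩
  fromℚ (p * p) +ʳ fromℚ (q * q) *ʳ fromℚ (ι 3)
    ≈⟨ pointwise (λ n → solve 2 (λ α β →
         (α :- con ½ :* β) :* (α :- con ½ :* β) :+ con ½ :* β :* (con ½ :* β) :* con (ι 3)
         := α :* α :- α :* β :+ β :* β) refl α β) ⟩
  fromℚ (normℚ α β) ∎
  where
  open ≈-Reasoning
  z : ℂ
  z = [ α , β ]ω
  p q : ℚ
  p = α - ½ * β
  q = ½ * β

∣∣ᶜ-cong : ∀ {z w} → z ≈ᶜ w → ∣ z ∣ᶜ ≈ ∣ w ∣ᶜ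
∣∣ᶜ-cong (re≈ , im≈) = √-cong (+ʳ-cong (*ʳ-cong re≈ re≈) (*ʳ-cong im≈ im≈))

∣z∣≈√norm : ∀ {z} α β → z ≈ᶜ [ α , β ]ω → ∣ z ∣ᶜ ≈ √ (fromℚ (normℚ α β))
∣z∣≈√norm α β z≈ = ≈-trans (∣∣ᶜ-cong z≈) (√-cong (∣[]ω∣² α β))

∣z-w∣≈∣w-z∣ : ∀ z w → ∣ z -ᶜ w ∣ᶜ ≈ ∣ w -ᶜ z ∣ᶜ
∣z-w∣≈∣w-z∣ z w = √-cong (pointwise (λ n → solve 4 (λ a b c d →
    (a :- c) :* (a :- c) :+ (b :- d) :* (b :- d) := (c :- a) :* (c :- a) :+ (d :- b) :* (d :- b))
  refl (seq (re z) n) (seq (im z) n) (seq (re w) n) (seq (im w) n)))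

other-difference : ∀ {a b c d} → b -ʳ a ≈ c -ʳ d → c -ʳ b ≈ d -ʳ a
other-difference {a} {b} {c} {d} b-a≈c-d = begin
  c -ʳ b                            ≈⟨ pointwise (λ n → solve 4 (λ a b c d →
    c :- b := c :- d :+ (d :- a) :- (b :- a)) refl (seq a n) (seq b n) (seq c n) (seq d n)) ⟩
  c -ʳ d +ʳ (d -ʳ a) -ʳ (b -ʳ a)    ≈⟨ sub-cong (+ʳ-cong b-a≈c-d ≈-refl) ≈-refl ⟨
  b -ʳ a +ʳ (d -ʳ a) -ʳ (b -ʳ a)    ≈⟨ pointwise (λ n → solve 3 (λ a b d →
    b :- a :+ (d :- a) :- (b :- a) := d :- a) refl (seq a n) (seq b n) (seq d n)) ⟩
  d -ʳ a                            ∎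
  where open ≈-Reasoning

fourth-vertex : ∀ {a b c d} → b -ʳ a ≈ c -ʳ d → c ≈ b +ʳ (d -ʳ a)
fourth-vertex {a} {b} {c} {d} b-a≈c-d = begin
  c                       ≈⟨ pointwise (λ n → solve 2 (λ c d → c := c :- d :+ d) refl (seq c n) (seq d n)) ⟩
  c -ʳ d +ʳ d             ≈⟨ +ʳ-cong b-a≈c-d ≈-refl ⟨
  b -ʳ a +ʳ d             ≈⟨ pointwise (λ n → solve 3 (λ a b d →
    b :- a :+ d := b :+ (d :- a)) refl (seq a n) (seq b n) (seq d n)) ⟩
  b +ʳ (d -ʳ a)           ∎
  where open ≈-Reasoning

-- Equable parallelograms

perimeter-parallelogram : ∀ A B C D → B -ᶜ A ≈ᶜ C -ᶜ D →
  let s = ∣ B -ᶜ A ∣ᶜ +ʳ ∣ D -ᶜ A ∣ᶜ in perimeter (A ∷ B ∷ C ∷ D ∷ []) ≈ s +ʳ s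
perimeter-parallelogram A B C D (re≈ , im≈) = ≈-trans
  (+ʳ-cong ≈-refl (+ʳ-cong
    (∣∣ᶜ-cong {C -ᶜ B} {D -ᶜ A} (other-difference re≈ , other-difference im≈)) (+ʳ-cong
    (≈-trans (∣z-w∣≈∣w-z∣ D C) (∣∣ᶜ-cong {C -ᶜ D} {B -ᶜ A} (≈-sym re≈ , ≈-sym im≈))) (+ʳ-cong
    (∣z-w∣≈∣w-z∣ A D) ≈-refl))))
  (pointwise (λ n → solve 2 (λ x y → x :+ (y :+ (x :+ (y :+ con 0ℚ))) := x :+ y :+ (x :+ y))
    refl (seq ∣ B -ᶜ A ∣ᶜ n) (seq ∣ D -ᶜ A ∣ᶜ n)))

-- Substituting C = B + (D - A) makes the shoelace sum independent of the position of A: it becomes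
-- twice the wedge of the two sides.
area-parallelogram : ∀ A B C D → B -ᶜ A ≈ᶜ C -ᶜ D →
  let w = (B -ᶜ A) ∧ (D -ᶜ A) in area (A ∷ B ∷ C ∷ D ∷ []) ≈ fromℚ ½ *ʳ ∣ w +ʳ w ∣ʳ
area-parallelogram A B C D (re≈ , im≈) = *ʳ-cong ≈-refl (∣∣ʳ-cong (begin
  A ∧ B +ʳ (B ∧ C +ʳ (C ∧ D +ʳ (D ∧ A +ʳ 0ʳ)))
    ≈⟨ +ʳ-cong ≈-refl (+ʳ-cong (∧-cong {B} {B} {C} {C′} (≈-refl , ≈-refl) C≈C′)
         (+ʳ-cong (∧-cong {C} {C′} {D} {D} C≈C′ (≈-refl , ≈-refl)) ≈-refl)) ⟩
  A ∧ B +ʳ (B ∧ C′ +ʳ (C′ ∧ D +ʳ (D ∧ A +ʳ 0ʳ)))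
    ≈⟨ pointwise (λ n → solve 6 (λ ax ay bx by dx dy →
         let cx = bx :+ (dx :- ax) ; cy = by :+ (dy :- ay)
             w = (bx :- ax) :* (dy :- ay) :- (by :- ay) :* (dx :- ax)
         in ax :* by :- ay :* bx :+ (bx :* cy :- by :* cx :+ (cx :* dy :- cy :* dx
              :+ (dx :* ay :- dy :* ax :+ con 0ℚ)))
            := w :+ w)
         refl (seq (re A) n) (seq (im A) n) (seq (re B) n) (seq (im B) n) (seq (re D) n) (seq (im D) n)) ⟩
  (B -ᶜ A) ∧ (D -ᶜ A) +ʳ (B -ᶜ A) ∧ (D -ᶜ A) ∎))
  where
  open ≈-Reasoning
  C′ : ℂ
  C′ = B +ᶜ (D -ᶜ A)
  C≈C′ : C ≈ᶜ C′
  C≈C′ = fourth-vertex re≈ , fourth-vertex im≈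

-- Four times the square of 2(x + y) is 16(x² + y²) + 32xy, and four times the square of the area is
-- 3Δ². So 32xy equals `e`, and squaring again leaves only x² and y².
equable-equation : ∀ A B C D α β γ δ → B -ᶜ A ≈ᶜ C -ᶜ D →
  B -ᶜ A ≈ᶜ [ α , β ]ω → D -ᶜ A ≈ᶜ [ γ , δ ]ω →
  perimeter (A ∷ B ∷ C ∷ D ∷ []) ≈ area (A ∷ B ∷ C ∷ D ∷ []) →
  let Δ = α * δ - β * γ ; e = ι 3 * (Δ * Δ) - ι 16 * (normℚ α β + normℚ γ δ) in
  e * e ≡ ι 1024 * (normℚ α β * normℚ γ δ)
equable-equation A B C D α β γ δ opposite u≈ v≈ equable = fromℚ-injective (begin
  fromℚ (e * e)
    ≈⟨ pointwise (λ _ → refl) ⟩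
  fromℚ e *ʳ fromℚ e
    ≈⟨ *ʳ-cong 32xy≈e 32xy≈e ⟨
  fromℚ (ι 32) *ʳ (x *ʳ y) *ʳ (fromℚ (ι 32) *ʳ (x *ʳ y))
    ≈⟨ pointwise (λ n → solve 2 (λ x y → con (ι 32) :* (x :* y) :* (con (ι 32) :* (x :* y))
         := con (ι 1024) :* (x :* x :* (y :* y))) refl (seq x n) (seq y n)) ⟩
  fromℚ (ι 1024) *ʳ ((x *ʳ x) *ʳ (y *ʳ y))
    ≈⟨ *ʳ-cong ≈-refl (*ʳ-cong x² y²) ⟩
  fromℚ (ι 1024) *ʳ (fromℚ (normℚ α β) *ʳ fromℚ (normℚ γ δ))
    ≈⟨ pointwise (λ _ → refl) ⟩
  fromℚ (ι 1024 * (normℚ α β * normℚ γ δ)) ∎)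
  where
  open ≈-Reasoning
  Δ e : ℚ
  Δ = α * δ - β * γ
  e = ι 3 * (Δ * Δ) - ι 16 * (normℚ α β + normℚ γ δ)
  x y s a w : ℝ
  x = √ (fromℚ (normℚ α β))
  y = √ (fromℚ (normℚ γ δ))
  s = ∣ B -ᶜ A ∣ᶜ +ʳ ∣ D -ᶜ A ∣ᶜ
  w = fromℚ (½ * Δ) *ʳ √3
  a = fromℚ ½ *ʳ ∣ w +ʳ w ∣ʳ
  x² : x *ʳ x ≈ fromℚ (normℚ α β)
  x² = √-square (normℚ α β) (0≤normℚ α β)
  y² : y *ʳ y ≈ fromℚ (normℚ γ δ)
  y² = √-square (normℚ γ δ) (0≤normℚ γ δ)
  s≈x+y : s ≈ x +ʳ y
  s≈x+y = +ʳ-cong (∣z∣≈√norm {B -ᶜ A} α β u≈) (∣z∣≈√norm {D -ᶜ A} γ δ v≈)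
  ∧≈w : (B -ᶜ A) ∧ (D -ᶜ A) ≈ w
  ∧≈w = ≈-trans (∧-cong {B -ᶜ A} {_} {D -ᶜ A} u≈ v≈) ([]ω-∧ α β γ δ)
  2[x+y]≈a : x +ʳ y +ʳ (x +ʳ y) ≈ a
  2[x+y]≈a = begin
    x +ʳ y +ʳ (x +ʳ y)                    ≈⟨ +ʳ-cong s≈x+y s≈x+y ⟨
    s +ʳ s                                ≈⟨ perimeter-parallelogram A B C D opposite ⟨
    perimeter (A ∷ B ∷ C ∷ D ∷ [])        ≈⟨ equable ⟩
    area (A ∷ B ∷ C ∷ D ∷ [])             ≈⟨ area-parallelogram A B C D opposite ⟩
    fromℚ ½ *ʳ ∣ (B -ᶜ A) ∧ (D -ᶜ A) +ʳ (B -ᶜ A) ∧ (D -ᶜ A) ∣ʳ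
                                          ≈⟨ *ʳ-cong ≈-refl (∣∣ʳ-cong (+ʳ-cong ∧≈w ∧≈w)) ⟩
    a                                     ∎
  -- Squaring removes the absolute value; √3 · √3 stays formal, so the identity is still termwise.
  4a² : fromℚ (ι 4) *ʳ (a *ʳ a) ≈ fromℚ (Δ * Δ) *ʳ (√3 *ʳ √3)
  4a² = pointwise (λ n → let v = ½ * Δ * seq √3 n + ½ * Δ * seq √3 n in
    trans (solve 1 (λ v → con (ι 4) :* (con ½ :* v :* (con ½ :* v)) := v :* v) refl ∣ v ∣)
    (trans (∣p∣²≡p² v)
      (solve 2 (λ Δ t → let v = con ½ :* Δ :* t :+ con ½ :* Δ :* t in v :* v := Δ :* Δ :* (t :* t))
        refl Δ (seq √3 n))))
  32xy≈e : fromℚ (ι 32) *ʳ (x *ʳ y) ≈ fromℚ e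
  32xy≈e = begin
    fromℚ (ι 32) *ʳ (x *ʳ y)
      ≈⟨ pointwise (λ n → solve 2 (λ x y → con (ι 32) :* (x :* y)
           := con (ι 4) :* ((x :+ y :+ (x :+ y)) :* (x :+ y :+ (x :+ y)))
              :- con (ι 16) :* (x :* x :+ y :* y)) refl (seq x n) (seq y n)) ⟩
    fromℚ (ι 4) *ʳ ((x +ʳ y +ʳ (x +ʳ y)) *ʳ (x +ʳ y +ʳ (x +ʳ y))) -ʳ fromℚ (ι 16) *ʳ (x *ʳ x +ʳ y *ʳ y)
      ≈⟨ sub-cong (*ʳ-cong ≈-refl (*ʳ-cong 2[x+y]≈a 2[x+y]≈a)) (*ʳ-cong ≈-refl (+ʳ-cong x² y²)) ⟩
    fromℚ (ι 4) *ʳ (a *ʳ a) -ʳ fromℚ (ι 16) *ʳ (fromℚ (normℚ α β) +ʳ fromℚ (normℚ γ δ))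
      ≈⟨ sub-cong (≈-trans 4a² (*ʳ-cong ≈-refl √3²)) ≈-refl ⟩
    fromℚ (Δ * Δ) *ʳ fromℚ (ι 3) -ʳ fromℚ (ι 16) *ʳ (fromℚ (normℚ α β) +ʳ fromℚ (normℚ γ δ))
      ≈⟨ pointwise (λ n → cong (_- ι 16 * (normℚ α β + normℚ γ δ)) (*-comm (Δ * Δ) (ι 3))) ⟩
    fromℚ e ∎

-- Descent to integer coordinates, and the vertical diagonals

/1-homo-minus : ∀ a b → (a ℤ.- b) / 1 ≡ a / 1 - b / 1
/1-homo-minus a b = trans (/1-homo-+ a (ℤ.- b)) (cong (_+_ (a / 1)) (/1-homo-neg b))

/1-homo-norm : ∀ a b → norm a b / 1 ≡ normℚ (a / 1) (b / 1)
/1-homo-norm a b = trans (/1-homo-+ (a ℤ.* a ℤ.- a ℤ.* b) (b ℤ.* b)) (cong₂ _+_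
  (trans (/1-homo-minus (a ℤ.* a) (a ℤ.* b)) (cong₂ _-_ (/1-homo-* a a) (/1-homo-* a b)))
  (/1-homo-* b b))

/1-homo-det : ∀ a b c d → (a ℤ.* d ℤ.- b ℤ.* c) / 1 ≡ a / 1 * (d / 1) - b / 1 * (c / 1)
/1-homo-det a b c d = trans (/1-homo-minus (a ℤ.* d) (b ℤ.* c)) (cong₂ _-_ (/1-homo-* a d) (/1-homo-* b c))

equable-equation-ℤ : ∀ a b c d →
  let α = a / 1 ; β = b / 1 ; γ = c / 1 ; δ = d / 1
      Δ = α * δ - β * γ ; e = ι 3 * (Δ * Δ) - ι 16 * (normℚ α β + normℚ γ δ)
      Δ′ = a ℤ.* d ℤ.- b ℤ.* c ; e′ = ℤ.+ 3 ℤ.* (Δ′ ℤ.* Δ′) ℤ.- ℤ.+ 16 ℤ.* (norm a b ℤ.+ norm c d) in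
  e * e ≡ ι 1024 * (normℚ α β * normℚ γ δ) → e′ ℤ.* e′ ≡ ℤ.+ 1024 ℤ.* (norm a b ℤ.* norm c d)
equable-equation-ℤ a b c d eq = /1-injective (begin
  (e′ ℤ.* e′) / 1                                   ≡⟨ /1-homo-* e′ e′ ⟩
  e′ / 1 * (e′ / 1)                                 ≡⟨ cong₂ _*_ e′/1 e′/1 ⟩
  e * e                                             ≡⟨ eq ⟩
  ι 1024 * (normℚ α β * normℚ γ δ)                  ≡⟨ cong (ι 1024 *_) (cong₂ _*_ (/1-homo-norm a b) (/1-homo-norm c d)) ⟨
  ι 1024 * (norm a b / 1 * (norm c d / 1))          ≡⟨ cong (ι 1024 *_) (/1-homo-* (norm a b) (norm c d)) ⟨
  ι 1024 * ((norm a b ℤ.* norm c d) / 1)            ≡⟨ /1-homo-* (ℤ.+ 1024) (norm a b ℤ.* norm c d) ⟨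
  (ℤ.+ 1024 ℤ.* (norm a b ℤ.* norm c d)) / 1        ∎)
  where
  open ≡-Reasoning
  α β γ δ Δ e : ℚ
  α = a / 1
  β = b / 1
  γ = c / 1
  δ = d / 1
  Δ = α * δ - β * γ
  e = ι 3 * (Δ * Δ) - ι 16 * (normℚ α β + normℚ γ δ)
  Δ′ e′ : ℤ
  Δ′ = a ℤ.* d ℤ.- b ℤ.* c
  e′ = ℤ.+ 3 ℤ.* (Δ′ ℤ.* Δ′) ℤ.- ℤ.+ 16 ℤ.* (norm a b ℤ.+ norm c d)
  e′/1 : e′ / 1 ≡ e
  e′/1 = trans (/1-homo-minus (ℤ.+ 3 ℤ.* (Δ′ ℤ.* Δ′)) (ℤ.+ 16 ℤ.* (norm a b ℤ.+ norm c d))) (cong₂ _-_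
    (trans (/1-homo-* (ℤ.+ 3) (Δ′ ℤ.* Δ′)) (cong (ι 3 *_) (trans (/1-homo-* Δ′ Δ′)
      (cong (λ Δ → Δ * Δ) (/1-homo-det a b c d)))))
    (trans (/1-homo-* (ℤ.+ 16) (norm a b ℤ.+ norm c d)) (cong (ι 16 *_)
      (trans (/1-homo-+ (norm a b) (norm c d)) (cong₂ _+_ (/1-homo-norm a b) (/1-homo-norm c d))))))

edge-coordinates : ∀ {z w} a b c d → z ≈ᶜ ℤ⇒ℂ a +ᶜ ℤ⇒ℂ b *ᶜ ω → w ≈ᶜ ℤ⇒ℂ c +ᶜ ℤ⇒ℂ d *ᶜ ω →
  w -ᶜ z ≈ᶜ [ (c ℤ.- a) / 1 , (d ℤ.- b) / 1 ]ω
edge-coordinates {z} {w} a b c d z≈ w≈ = subst₂ (λ α β → w -ᶜ z ≈ᶜ [ α , β ]ω)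
  (sym (/1-homo-minus c a)) (sym (/1-homo-minus d b))
  (≈ᶜ-trans {w -ᶜ z} (sub-congᶜ {w} {_} {z} w≈ z≈) ([]ω-sub (a / 1) (b / 1) (c / 1) (d / 1)))

Δ≡0⇒∧≈0 : ∀ α β γ δ → α * δ - β * γ ≡ 0ℚ → [ α , β ]ω ∧ [ γ , δ ]ω ≈ 0ʳ
Δ≡0⇒∧≈0 α β γ δ Δ≡0 = ≈-trans ([]ω-∧ α β γ δ) (pointwise (λ n →
  trans (cong (λ Δ → ½ * Δ * seq √3 n) Δ≡0) (solve 1 (λ t → con ½ :* con 0ℚ :* t := con 0ℚ) refl (seq √3 n))))

-- The left side of the hypothesis is the real part of u + v in coordinates; doubling clears its
-- denominator.
re≡0⇒2[a+c]≡b+d : ∀ a b c d → a / 1 - ½ * (b / 1) + (c / 1 - ½ * (d / 1)) ≡ 0ℚ →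
  ℤ.+ 2 ℤ.* (a ℤ.+ c) ≡ b ℤ.+ d
re≡0⇒2[a+c]≡b+d a b c d eq = /1-injective (begin
  (ℤ.+ 2 ℤ.* (a ℤ.+ c)) / 1         ≡⟨ /1-homo-* (ℤ.+ 2) (a ℤ.+ c) ⟩
  ι 2 * ((a ℤ.+ c) / 1)             ≡⟨ cong (ι 2 *_) (/1-homo-+ a c) ⟩
  ι 2 * (a / 1 + c / 1)             ≡⟨ solve 4 (λ α β γ δ → con (ι 2) :* (α :+ γ)
    := con (ι 2) :* (α :- con ½ :* β :+ (γ :- con ½ :* δ)) :+ (β :+ δ)) refl (a / 1) (b / 1) (c / 1) (d / 1) ⟩
  ι 2 * (a / 1 - ½ * (b / 1) + (c / 1 - ½ * (d / 1))) + (b / 1 + d / 1)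
                                    ≡⟨ cong (λ r → ι 2 * r + (b / 1 + d / 1)) eq ⟩
  0ℚ + (b / 1 + d / 1)              ≡⟨ +-identityˡ (b / 1 + d / 1) ⟩
  b / 1 + d / 1                     ≡⟨ /1-homo-+ b d ⟨
  (b ℤ.+ d) / 1                     ∎)
  where open ≡-Reasoning

re-difference : ∀ {z w} α β → w -ᶜ z ≈ᶜ [ α , β ]ω → re w -ʳ re z ≈ fromℚ (α - ½ * β)
re-difference α β (re≈ , _) = ≈-trans re≈ (re-[]ω α β)

sub≈0 : ∀ {x y} → x ≈ y → x -ʳ y ≈ 0ʳ
sub≈0 {x} {y} x≈y = ≈-trans (sub-cong x≈y ≈-refl) (pointwise (λ n → +-inverseʳ (seq y n)))

vertical-AC : ∀ A B C D α β γ δ → B -ᶜ A ≈ᶜ C -ᶜ D →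
  B -ᶜ A ≈ᶜ [ α , β ]ω → D -ᶜ A ≈ᶜ [ γ , δ ]ω → Vertical A C → α - ½ * β + (γ - ½ * δ) ≡ 0ℚ
vertical-AC A B C D α β γ δ (re≈ , _) u≈ v≈ vertical = fromℚ-injective (begin
  fromℚ (α - ½ * β + (γ - ½ * δ))             ≈⟨ pointwise (λ _ → refl) ⟩
  fromℚ (α - ½ * β) +ʳ fromℚ (γ - ½ * δ)      ≈⟨ +ʳ-cong (re-difference {A} {B} α β u≈) (re-difference {A} {D} γ δ v≈) ⟨
  re B -ʳ re A +ʳ (re D -ʳ re A)              ≈⟨ pointwise (λ n → solve 3 (λ a b d →
    b :- a :+ (d :- a) := b :+ (d :- a) :- a) refl (seq (re A) n) (seq (re B) n) (seq (re D) n)) ⟩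
  re B +ʳ (re D -ʳ re A) -ʳ re A              ≈⟨ sub-cong (fourth-vertex re≈) ≈-refl ⟨
  re C -ʳ re A                                ≈⟨ sub≈0 (≈-sym (≃⇒≈ vertical)) ⟩
  0ʳ                                          ∎)
  where open ≈-Reasoning

-- The diagonal from D to B is u + (-v); the negated coordinates put this in the shape that
-- `vertical-AC` gives for u + v.
vertical-BD : ∀ A B D α β γ δ →
  B -ᶜ A ≈ᶜ [ α , β ]ω → D -ᶜ A ≈ᶜ [ γ , δ ]ω → Vertical B D → α - ½ * β + (- γ - ½ * - δ) ≡ 0ℚ
vertical-BD A B D α β γ δ u≈ v≈ vertical = fromℚ-injective (begin
  fromℚ (α - ½ * β + (- γ - ½ * - δ))         ≈⟨ pointwise (λ _ → solve 4 (λ α β γ δ →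
    α :- con ½ :* β :+ (:- γ :- con ½ :* :- δ) := α :- con ½ :* β :- (γ :- con ½ :* δ)) refl α β γ δ) ⟩
  fromℚ (α - ½ * β) -ʳ fromℚ (γ - ½ * δ)      ≈⟨ sub-cong (re-difference {A} {B} α β u≈) (re-difference {A} {D} γ δ v≈) ⟨
  re B -ʳ re A -ʳ (re D -ʳ re A)              ≈⟨ pointwise (λ n → solve 3 (λ a b d →
    b :- a :- (d :- a) := b :- d) refl (seq (re A) n) (seq (re B) n) (seq (re D) n)) ⟩
  re B -ʳ re D                                ≈⟨ sub≈0 (≃⇒≈ vertical) ⟩
  0ʳ                                          ∎)
  where open ≈-Reasoning

no-vertical-diagonal : ∀ A B C D a b c d → B -ᶜ A ≈ᶜ C -ᶜ D → ¬ Collinear A B D →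
  B -ᶜ A ≈ᶜ [ a / 1 , b / 1 ]ω → D -ᶜ A ≈ᶜ [ c / 1 , d / 1 ]ω →
  Equable (A ∷ B ∷ C ∷ D ∷ []) → ¬ (Vertical A C ⊎ Vertical B D)
no-vertical-diagonal A B C D a b c d opposite nondegenerate u≈ v≈ equable = λ
  { (inj₁ vertical) → norm-equation-insoluble a b c d
      (re≡0⇒2[a+c]≡b+d a b c d (vertical-AC A B C D (a / 1) (b / 1) (c / 1) (d / 1) opposite u≈ v≈ vertical)) Δ≢0 eq
  ; (inj₂ vertical) → norm-equation-insoluble′ a b c d
      (re≡0⇒2[a+c]≡b+d a b (ℤ.- c) (ℤ.- d) (subst₂ (λ γ δ → a / 1 - ½ * (b / 1) + (γ - ½ * δ) ≡ 0ℚ)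
        (sym (/1-homo-neg c)) (sym (/1-homo-neg d))
        (vertical-BD A B D (a / 1) (b / 1) (c / 1) (d / 1) u≈ v≈ vertical))) Δ≢0 eq
  }
  where
  eq : let Δ = a ℤ.* d ℤ.- b ℤ.* c ; e = ℤ.+ 3 ℤ.* (Δ ℤ.* Δ) ℤ.- ℤ.+ 16 ℤ.* (norm a b ℤ.+ norm c d) in
    e ℤ.* e ≡ ℤ.+ 1024 ℤ.* (norm a b ℤ.* norm c d)
  eq = equable-equation-ℤ a b c d
    (equable-equation A B C D (a / 1) (b / 1) (c / 1) (d / 1) opposite u≈ v≈ (≃⇒≈ equable))
  Δ≢0 : a ℤ.* d ℤ.- b ℤ.* c ≢ ℤ.+ 0
  -- A zero determinant would make the wedge of the two sides vanish, and A, B, D collinear.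
  Δ≢0 Δ≡0 = nondegenerate (≈⇒≃ (≈-trans (∧-cong {B -ᶜ A} {_} {D -ᶜ A} u≈ v≈)
    (Δ≡0⇒∧≈0 (a / 1) (b / 1) (c / 1) (d / 1) (trans (sym (/1-homo-det a b c d)) (cong (_/ 1) Δ≡0)))))

theorem6 : ¬ (∃ λ (P : Parallelogram) → IsELEP P × HasVerticalDiagonal P)
theorem6 (P , (equable , (aA , bA , A≃) ∷ (aB , bB , B≃) ∷ _ ∷ (aD , bD , D≃) ∷ []) , vertical) =
  no-vertical-diagonal A B C D (aB ℤ.- aA) (bB ℤ.- bA) (aD ℤ.- aA) (bD ℤ.- bA)
    (≃ᶜ⇒≈ᶜ opposite) nondegenerate
    (edge-coordinates {A} {B} aA bA aB bB (≃ᶜ⇒≈ᶜ A≃) (≃ᶜ⇒≈ᶜ B≃))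
    (edge-coordinates {A} {D} aA bA aD bD (≃ᶜ⇒≈ᶜ A≃) (≃ᶜ⇒≈ᶜ D≃))
    equable vertical
  where open Parallelogram P
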